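{- Let $G$ be a topological group, let $\mathfrak M$ be an I-finite $G$-Mackey system and let $\mathcal U$ be a descent basis for $\mathfrak M$. Then the functor $(-)^*_{\mathcal U}:\mathsf{Mack}(\mathfrak M,\mathsf{Ab})\to{}_G\mathsf{Ab}^{\mathrm d}$ is left adjoint to the functor $(-)_*:{}_G\mathsf{Ab}^{\mathrm d}\to\mathsf{Mack}(\mathfrak M,\mathsf{Ab})$.
   Context: ${}_G\mathsf{Ab}^{\mathrm d}$ is the category of discrete $G$-modules. ${}^gH=gHg^{ -1}$, $H^g=g^{ -1}Hg$. A $G$-subgroup system $\mathfrak S=(\mathfrak S_{\mathrm b},\mathfrak S_{\mathrm r},\mathfrak S_{\mathrm i})$ consists of a non-empty set $\mathfrak S_{\mathrm b}$ of subgroups of $G$ closed under conjugation and, for each $H\in\mathfrak S_{\mathrm b}$ and $\star\in\{\mathrm r,\mathrm i\}$, a set $\mathfrak S_\star(H)\subseteq\{I\in\mathfrak S_{\mathrm b}:I\le H\}$ with $H\in\mathfrak S_\star(H)$; $I\in\mathfrak S_\star(H)\Rightarrow\mathfrak S_\star(I)\subseteq\mathfrak S_\star(H)$; ${}^g\mathfrak S_\star(H)=\mathfrak S_\star({}^gH)$. It is I-finite if $[H:I]<\infty$ for $I\in\mathfrak S_{\mathrm i}(H)$. It is a $G$-Mackey system if for $I\in\mathfrak S_{\mathrm r}(H)$, $J\in\mathfrak S_{\mathrm i}(H)$ the set $I\backslash H/J$ is finite, $I\cap J\in\mathfrak S_{\mathrm r}(J)$ and $I\cap J\in\mathfrak S_{\mathrm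 i}(I)$. A Mackey functor $\Phi:\mathfrak M\to\mathsf{Ab}$ consists of abelian groups $\Phi(H)$ ($H\in\mathfrak M_{\mathrm b}$) and homomorphisms $\mathrm{res}_{I,H}:\Phi(H)\to\Phi(I)$ ($I\in\mathfrak M_{\mathrm r}(H)$), $\mathrm{ind}_{H,I}:\Phi(I)\to\Phi(H)$ ($I\in\mathfrak M_{\mathrm i}(H)$), $\mathrm{con}_{g,H}:\Phi(H)\to\Phi({}^gH)$ ($g\in G$) with: $\mathrm{res}_{H,H}=\mathrm{ind}_{H,H}=\mathrm{id}$, $\mathrm{con}_{h,H}=\mathrm{id}$ for $h\in H$; $\mathrm{res}_{J,I}\mathrm{res}_{I,H}=\mathrm{res}_{J,H}$, $\mathrm{ind}_{H,I}\mathrm{ind}_{I,J}=\mathrm{ind}_{H,J}$, $\mathrm{con}_{g',{}^gH}\mathrm{con}_{g,H}=\mathrm{con}_{g'g,H}$; $\mathrm{con}_{g,I}\mathrm{res}_{I,H}=\mathrm{res}_{{}^gI,{}^gH}\mathrm{con}_{g,H}$, $\mathrm{con}_{g,H}\mathrm{ind}_{H,I}=\mathrm{ind}_{{}^gH,{}^gI}\mathrm{con}_{g,I}$; and $\mathrm{res}_{I,H}\mathrm{ind}_{H,J}=\sum_{h}\mathrm{ind}_{I,I\cap{}^hJ}\,\mathrm{con}_{h,I^h\cap J}\,\mathrm{res}_{I^h\cap J,J}$ ($h$ over representatives of $I\backslash H/J$) for $I\in\mathfrak M_{\mathrm r}(H)$, $J\in\mathfrak M_{\mathrm i}(H)$.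 Morphisms are families of homomorphisms commuting with res, ind, con; the category is $\mathsf{Mack}(\mathfrak M,\mathsf{Ab})$. A descent basis for $\mathfrak M$ is a subset $\mathcal U\subseteq\mathfrak M_{\mathrm b}$ of open normal subgroups of $G$ which is a filter basis on $G$ (non-empty, and any two members contain a third in their intersection) such that $\mathcal U(H):=\{U\in\mathcal U:U\le H\}\subseteq\mathfrak M_{\mathrm r}(H)$ and $\mathcal U(H)\ne\emptyset$ for each $H\in\mathfrak M_{\mathrm b}$. The functor $(-)_*$: $A_*(H)=A^H$, res = inclusion $A^H\to A^I$, $\mathrm{ind}_{H,I}(a)=\sum_{h\in H/I}ha$, $\mathrm{con}_{g,H}(a)=ga$; on morphisms by restriction. The functor $(-)^*_{\mathcal U}$: $\Phi^*_{\mathcal U}=\mathrm{colim}_{U\in(\mathcal U,\supseteq)}\Phi(U)$ along the restrictions $\mathrm{res}_{V,U}$ ($U\supseteq V$), with $g\in G$ acting on the class of $a\in\Phi(U)$ as the class of $\mathrm{con}_{g,U}(a)\in\Phi(U)$ (a discrete $G$-module); on morphisms induced by the $\varphi_U$. -}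

module Defs where

open import Level using (Level; _⊔_) renaming (suc to lsuc)
open import Algebra.Bundles using (Group; AbelianGroup; RawGroup)
open import Algebra.Morphism.Bundles using (GroupHomomorphism)
import Algebra.Morphism.GroupMonomorphism as GroupMono
open import Algebra.Morphism.Structures using (IsGroupMonomorphism)
import Algebra.Properties.CommutativeMonoid.Sum as Summation
import Algebra.Properties.Group as GroupProperties
open import Data.Empty using (⊥-elim)
open import Data.Fin.Base using (Fin; zero; suc; punchIn)
open import Data.Fin.Properties using (_≟_; punchInᵢ≢i)
open import Data.Nat.Base using (ℕ; zero; suc)
open import Data.Product.Base using (Σ; ∃; ∃₂; _×_; _,_; proj₁; proj₂)
open import Data.Unit.Polymorphic.Base using (⊤)
open import Data.Vec.Functional using (removeAt)
open import Function.Base using (_∘_)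
open import Function.Bundles using (Inverse)
import Function.Construct.Identity as Identity
open import Relation.Binary.Bundles using (Setoid)
open import Relation.Binary.Core using (Rel)
open import Relation.Binary.Definitions using (_Respects_)
open import Relation.Binary.PropositionalEquality.Core as ≡ using (_≡_; _≢_)
open import Relation.Binary.PropositionalEquality.Properties using () renaming (setoid to ≡-setoid)
import Relation.Binary.Reasoning.Setoid as SetoidReasoning
open import Relation.Binary.Structures using (IsEquivalence)
open import Relation.Nullary.Decidable.Core using (Dec; yes; no)
open import Relation.Unary using (Pred; _∈_; _⊆_; _≐_; _∩_; ⋃)

record Category (o h e : Level) : Set (lsuc (o ⊔ h ⊔ e)) where
  infix  4 _≈_
  infixr 9 _∘ᶜ_
  field
    Obj           : Set o
    _⇒_           : Obj → Obj → Set h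
    _≈_           : ∀ {A B} → Rel (A ⇒ B) e
    isEquivalence : ∀ {A B} → IsEquivalence (_≈_ {A} {B})
    idᶜ           : ∀ {A} → A ⇒ A
    _∘ᶜ_          : ∀ {A B C} → B ⇒ C → A ⇒ B → A ⇒ C
    ∘-resp-≈      : ∀ {A B C} {f f′ : B ⇒ C} {g g′ : A ⇒ B} →
                    f ≈ f′ → g ≈ g′ → f ∘ᶜ g ≈ f′ ∘ᶜ g′
    identityˡ     : ∀ {A B} (f : A ⇒ B) → idᶜ ∘ᶜ f ≈ f
    identityʳ     : ∀ {A B} (f : A ⇒ B) → f ∘ᶜ idᶜ ≈ f
    assoc         : ∀ {A B C D} (f : C ⇒ D) (g : B ⇒ C) (h : A ⇒ B) →
                    (f ∘ᶜ g) ∘ᶜ h ≈ f ∘ᶜ (g ∘ᶜ h)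

  Hom : Obj → Obj → Setoid h e
  Hom A B = record { Carrier = A ⇒ B ; _≈_ = _≈_ ; isEquivalence = isEquivalence }

record Functor {o h e o′ h′ e′} (C : Category o h e) (D : Category o′ h′ e′)
  : Set (o ⊔ h ⊔ e ⊔ o′ ⊔ h′ ⊔ e′) where
  private
    module C = Category C
    module D = Category D
  field
    F₀       : C.Obj → D.Obj
    F₁       : ∀ {A B} → A C.⇒ B → F₀ A D.⇒ F₀ B
    F-resp-≈ : ∀ {A B} {f g : A C.⇒ B} → f C.≈ g → F₁ f D.≈ F₁ g
    F-id     : ∀ {A} → F₁ (C.idᶜ {A}) D.≈ D.idᶜ
    F-∘      : ∀ {A B E} (f : B C.⇒ E) (g : A C.⇒ B) → F₁ (f C.∘ᶜ g) D.≈ F₁ f D.∘ᶜ F₁ g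

infix 4 _⊣_

record _⊣_ {o h e o′ h′ e′} {C : Category o h e} {D : Category o′ h′ e′}
  (L : Functor C D) (R : Functor D C) : Set (o ⊔ h ⊔ e ⊔ o′ ⊔ h′ ⊔ e′) where
  private
    module C = Category C
    module D = Category D
    module L = Functor L
    module R = Functor R
  field
    transpose : ∀ X Y → Inverse (D.Hom (L.F₀ X) Y) (C.Hom X (R.F₀ Y))
    natural   : ∀ {X X′ Y Y′} (k : X′ C.⇒ X) (h : Y D.⇒ Y′) (f : L.F₀ X D.⇒ Y) →
                Inverse.to (transpose X′ Y′) (h D.∘ᶜ (f D.∘ᶜ L.F₁ k)) C.≈
                R.F₁ h C.∘ᶜ (Inverse.to (transpose X Y) f C.∘ᶜ k)

open GroupHomomorphism using () renaming (⟦_⟧ to infixl 20 _$_)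

module _ {a : Level} where

  infix 4 _⟶_

  _⟶_ : AbelianGroup a a → AbelianGroup a a → Set a
  A ⟶ B = GroupHomomorphism (AbelianGroup.rawGroup A) (AbelianGroup.rawGroup B)

  mkHom : (A B : AbelianGroup a a) → let open AbelianGroup in (f : Carrier A → Carrier B) →
          (∀ {x y} → _≈_ A x y → _≈_ B (f x) (f y)) →
          (∀ x y → _≈_ B (f (_∙_ A x y)) (_∙_ B (f x) (f y))) → A ⟶ B
  mkHom A B f f-cong f-homo = record
    { ⟦_⟧ = f
    ; isGroupHomomorphism = record
      { isMonoidHomomorphism = record
        { isMagmaHomomorphism = record
          { isRelHomomorphism = record { cong = f-cong } ; homo = f-homo }
        ; ε-homo = f-ε
        }
      ; ⁻¹-homo = λ x → inverseʳ-unique (f x) (f (x A.⁻¹))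
          (B.trans (B.sym (f-homo x (x A.⁻¹))) (B.trans (f-cong (A.inverseʳ x)) f-ε))
      }
    }
    where
    module A = AbelianGroup A
    module B = AbelianGroup B
    open GroupProperties B.group using (inverseʳ-unique; identityʳ-unique)
    f-ε : f A.ε B.≈ B.ε
    f-ε = identityʳ-unique (f A.ε) (f A.ε)
            (B.trans (B.sym (f-homo A.ε A.ε)) (f-cong (A.identityˡ A.ε)))

  id⟶ : {A : AbelianGroup a a} → A ⟶ A
  id⟶ {A} = mkHom A A (λ x → x) (λ p → p) (λ _ _ → AbelianGroup.refl A)

  infixr 9 _∘⟶_

  _∘⟶_ : {A B C : AbelianGroup a a} → B ⟶ C → A ⟶ B → A ⟶ C
  _∘⟶_ {A} {B} {C} f g = mkHom A C (λ x → f $ (g $ x))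
    (λ p → f.⟦⟧-cong (g.⟦⟧-cong p))
    (λ x y → C.trans (f.⟦⟧-cong (g.homo x y)) (f.homo (g $ x) (g $ y)))
    where
    module C = AbelianGroup C
    module f = GroupHomomorphism f
    module g = GroupHomomorphism g

  ∑ : (A : AbelianGroup a a) {n : ℕ} → (Fin n → AbelianGroup.Carrier A) → AbelianGroup.Carrier A
  ∑ A = Summation.sum (AbelianGroup.commutativeMonoid A)

  hom-∑ : {A B : AbelianGroup a a} (f : A ⟶ B) {n : ℕ} (t : Fin n → AbelianGroup.Carrier A) →
          AbelianGroup._≈_ B (f $ ∑ A t) (∑ B (λ k → f $ t k))
  hom-∑         f {zero}  t = GroupHomomorphism.ε-homo f
  hom-∑ {A} {B} f {suc n} t = trans (homo (t zero) (∑ A (t ∘ suc))) (∙-congˡ (hom-∑ {A} {B} f (t ∘ suc)))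
    where
    open AbelianGroup B using (trans; ∙-congˡ)
    open GroupHomomorphism f using (homo)


-- Inverse.to of an enumeration of a quotient setoid lists a system of
-- representatives.
Enumeration : {c e : Level} → ℕ → Setoid c e → Set (c ⊔ e)
Enumeration n S = Inverse (≡-setoid (Fin n)) S

Finite : {c e : Level} → Setoid c e → Set (c ⊔ e)
Finite S = ∃ λ n → Enumeration n S

module SumProperties {a : Level} (A : AbelianGroup a a) where
  open AbelianGroup A
  open Summation commutativeMonoid
  open SetoidReasoning setoid
  open Inverse using (to; from; to-cong; from-cong; strictlyInverseˡ; strictlyInverseʳ)

  ∑-zero : {n : ℕ} (t : Fin n → Carrier) → (∀ j → t j ≈ ε) → ∑ A t ≈ ε
  ∑-zero {n} t t≈ε = trans (sum-cong-≋ t≈ε) (sum-replicate-zero n)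

  ∑-single : {n : ℕ} (i : Fin n) (t : Fin n → Carrier) → (∀ j → j ≢ i → t j ≈ ε) → ∑ A t ≈ t i
  ∑-single {suc n} i t t≈ε = begin
    ∑ A t                      ≈⟨ sum-remove {i = i} t ⟩
    t i ∙ ∑ A (removeAt t i)   ≈⟨ ∙-congˡ (∑-zero (removeAt t i) (λ j → t≈ε (punchIn i j) (punchInᵢ≢i i j))) ⟩
    t i ∙ ε                    ≈⟨ identityʳ (t i) ⟩
    t i                        ∎

  when : {P : Set} → Dec P → Carrier → Carrier
  when (yes _) x = x
  when (no _)  x = ε

  when-yes : {P : Set} (d : Dec P) (x : Carrier) → P → when d x ≈ x
  when-yes (yes _) x p = refl
  when-yes (no ¬p) x p = ⊥-elim (¬p p)

  when-no : {P : Set} (d : Dec P) (x : Carrier) → (P → x ≈ ε) → when d x ≈ ε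
  when-no (yes p) x h = h p
  when-no (no _)  x h = refl

  ∑-partition : {N n : ℕ} {s : Fin n → ℕ} (φ : ∀ k → Fin (s k) → Fin N) →
                (∀ m → ∃₂ λ k l → φ k l ≡ m) →
                (∀ {k l k′ l′} → φ k l ≡ φ k′ l′ → k ≡ k′) →
                (∀ {k l l′} → φ k l ≡ φ k l′ → l ≡ l′) →
                (f : Fin N → Carrier) → ∑ A f ≈ ∑ A (λ k → ∑ A (λ l → f (φ k l)))
  ∑-partition φ surj inj₁ inj₂ f = begin
    ∑ A f                                                          ≈⟨ sum-cong-≋ expand ⟩
    ∑ A (λ m → ∑ A (λ k → ∑ A (λ l → when (φ k l ≟ m) (f m))))     ≈⟨ ∑-comm (λ m k → ∑ A (λ l → when (φ k l ≟ m) (f m))) ⟩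
    ∑ A (λ k → ∑ A (λ m → ∑ A (λ l → when (φ k l ≟ m) (f m))))     ≈⟨ sum-cong-≋ (λ k → ∑-comm (λ m l → when (φ k l ≟ m) (f m))) ⟩
    ∑ A (λ k → ∑ A (λ l → ∑ A (λ m → when (φ k l ≟ m) (f m))))     ≈⟨ sum-cong-≋ (λ k → sum-cong-≋ (λ l → collapse k l)) ⟩
    ∑ A (λ k → ∑ A (λ l → f (φ k l)))                              ∎
    where
    expand : ∀ m → f m ≈ ∑ A (λ k → ∑ A (λ l → when (φ k l ≟ m) (f m)))
    expand m with surj m
    ... | k₀ , l₀ , ≡.refl = sym (begin
      ∑ A (λ k → ∑ A (λ l → when (φ k l ≟ m) (f m)))
        ≈⟨ ∑-single k₀ _ (λ k k≢k₀ → ∑-zero _ (λ l → when-no (φ k l ≟ m) (f m) (λ p → ⊥-elim (k≢k₀ (inj₁ p))))) ⟩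
      ∑ A (λ l → when (φ k₀ l ≟ m) (f m))
        ≈⟨ ∑-single l₀ _ (λ l l≢l₀ → when-no (φ k₀ l ≟ m) (f m) (λ p → ⊥-elim (l≢l₀ (inj₂ p)))) ⟩
      when (φ k₀ l₀ ≟ m) (f m)
        ≈⟨ when-yes (φ k₀ l₀ ≟ m) (f m) ≡.refl ⟩
      f m ∎)
    collapse : ∀ k l → ∑ A (λ m → when (φ k l ≟ m) (f m)) ≈ f (φ k l)
    collapse k l = trans
      (∑-single (φ k l) _ (λ m m≢ → when-no (φ k l ≟ m) (f m) (λ p → ⊥-elim (m≢ (≡.sym p)))))
      (when-yes (φ k l ≟ φ k l) _ ≡.refl)

  module _ {c e : Level} (S : Setoid c e) (f : Setoid.Carrier S → Carrier)
           (f-cong : ∀ {x y} → Setoid._≈_ S x y → f x ≈ f y) where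
    private module S = Setoid S

    ∑-fibres : {N : ℕ} (eS : Enumeration N S) {n : ℕ} {s : Fin n → ℕ}
               {T : Fin n → Setoid c e} (eT : ∀ k → Enumeration (s k) (T k))
               (ψ : ∀ k → Setoid.Carrier (T k) → S.Carrier) →
               (∀ k {x y} → Setoid._≈_ (T k) x y → ψ k x S.≈ ψ k y) →
               (∀ x → ∃₂ λ k y → ψ k y S.≈ x) →
               (∀ {k l k′ l′} → ψ k (to (eT k) l) S.≈ ψ k′ (to (eT k′) l′) → k ≡ k′) →
               (∀ {k x y} → ψ k x S.≈ ψ k y → Setoid._≈_ (T k) x y) →
               ∑ A (λ m → f (to eS m)) ≈ ∑ A (λ k → ∑ A (λ l → f (ψ k (to (eT k) l))))
    ∑-fibres eS {n} {s} eT ψ ψ-cong surj inj₁ inj₂ = trans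
      (∑-partition φ φ-surj (λ p → inj₁ (reflect p)) φ-inj₂ (λ m → f (to eS m)))
      (sum-cong-≋ {n} (λ k → sum-cong-≋ {s k} (λ l → f-cong (strictlyInverseˡ eS (ψ k (to (eT k) l))))))
      where
      φ : ∀ k → Fin (s k) → Fin _
      φ k l = from eS (ψ k (to (eT k) l))
      reflect : ∀ {x y} → from eS x ≡ from eS y → x S.≈ y
      reflect {x} {y} p = S.trans (S.sym (strictlyInverseˡ eS x)) (S.trans (to-cong eS p) (strictlyInverseˡ eS y))
      φ-surj : ∀ m → ∃₂ λ k l → φ k l ≡ m
      φ-surj m with surj (to eS m)
      ... | k , y , p = k , from (eT k) y , ≡.trans
        (from-cong eS (S.trans (ψ-cong k (strictlyInverseˡ (eT k) y)) p))
        (strictlyInverseʳ eS m)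
      φ-inj₂ : ∀ {k l l′} → φ k l ≡ φ k l′ → l ≡ l′
      φ-inj₂ {k} {l} {l′} p = ≡.trans (≡.sym (strictlyInverseʳ (eT k) l))
        (≡.trans (from-cong (eT k) (inj₂ (reflect p))) (strictlyInverseʳ (eT k) l′))

    ∑-bijection : {T : Setoid c e} (ψ : Inverse T S) {m n : ℕ}
                  (eS : Enumeration m S) (eT : Enumeration n T) →
                  ∑ A (λ k → f (to eS k)) ≈ ∑ A (λ k → f (to ψ (to eT k)))
    ∑-bijection {T} ψ {n = n} eS eT = trans
      (sum-permute (λ k → f (to eS k)) π)
      (sum-cong-≋ {n} (λ k → f-cong (strictlyInverseˡ eS (to ψ (to eT k)))))
      where
      module T = Setoid T
      π = record
        { to = λ k → from eS (to ψ (to eT k))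
        ; from = λ k → from eT (from ψ (to eS k))
        ; to-cong = λ { ≡.refl → ≡.refl }
        ; from-cong = λ { ≡.refl → ≡.refl }
        ; inverse =
            (λ { ≡.refl → ≡.trans (from-cong eS (S.trans (to-cong ψ (strictlyInverseˡ eT _)) (strictlyInverseˡ ψ _))) (strictlyInverseʳ eS _) })
          , (λ { ≡.refl → ≡.trans (from-cong eT (T.trans (from-cong ψ (strictlyInverseˡ eS _)) (strictlyInverseʳ ψ _))) (strictlyInverseʳ eT _) })
        }

module _ {ℓ : Level} (G : Group ℓ ℓ) where
  open Group G

  record Subgroup : Set (lsuc ℓ) where
    field
      elements : Pred Carrier ℓ
      resp     : elements Respects _≈_
      ε-mem    : ε ∈ elements
      ∙-mem    : ∀ {x y} → x ∈ elements → y ∈ elements → x ∙ y ∈ elements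
      ⁻¹-mem   : ∀ {x} → x ∈ elements → x ⁻¹ ∈ elements

module Conjugation {ℓ : Level} (G : Group ℓ ℓ) where
  open Group G
  open GroupProperties G
  open SetoidReasoning setoid

  infixl 8 _^ᵍ_

  _^ᵍ_ : Carrier → Carrier → Carrier
  x ^ᵍ g = g ⁻¹ ∙ x ∙ g

  ^-cong : ∀ {x y g h} → x ≈ y → g ≈ h → x ^ᵍ g ≈ y ^ᵍ h
  ^-cong p q = ∙-cong (∙-cong (⁻¹-cong q) p) q

  ^-∙ : ∀ x y g → (x ∙ y) ^ᵍ g ≈ x ^ᵍ g ∙ y ^ᵍ g
  ^-∙ x y g = sym (begin
    g ⁻¹ ∙ x ∙ g ∙ (g ⁻¹ ∙ y ∙ g)     ≈⟨ assoc _ _ _ ⟩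
    g ⁻¹ ∙ x ∙ (g ∙ (g ⁻¹ ∙ y ∙ g))   ≈⟨ ∙-congˡ (assoc _ _ _) ⟨
    g ⁻¹ ∙ x ∙ (g ∙ (g ⁻¹ ∙ y) ∙ g)   ≈⟨ ∙-congˡ (∙-congʳ (\\-leftDividesˡ g y)) ⟩
    g ⁻¹ ∙ x ∙ (y ∙ g)                ≈⟨ assoc _ _ _ ⟨
    g ⁻¹ ∙ x ∙ y ∙ g                  ≈⟨ ∙-congʳ (assoc _ _ _) ⟩
    g ⁻¹ ∙ (x ∙ y) ∙ g                ∎)

  ^-ε : ∀ g → ε ^ᵍ g ≈ ε
  ^-ε g = trans (∙-congʳ (identityʳ (g ⁻¹))) (inverseˡ g)

  ^-⁻¹ : ∀ x g → (x ⁻¹) ^ᵍ g ≈ (x ^ᵍ g) ⁻¹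
  ^-⁻¹ x g = inverseˡ-unique _ _ (begin
    (x ⁻¹) ^ᵍ g ∙ x ^ᵍ g  ≈⟨ ^-∙ (x ⁻¹) x g ⟨
    (x ⁻¹ ∙ x) ^ᵍ g       ≈⟨ ^-cong (inverseˡ x) refl ⟩
    ε ^ᵍ g                ≈⟨ ^-ε g ⟩
    ε                     ∎)

  ^-assoc : ∀ x g h → (x ^ᵍ g) ^ᵍ h ≈ x ^ᵍ (g ∙ h)
  ^-assoc x g h = begin
    h ⁻¹ ∙ (g ⁻¹ ∙ x ∙ g) ∙ h     ≈⟨ ∙-congʳ (assoc _ _ _) ⟨
    h ⁻¹ ∙ (g ⁻¹ ∙ x) ∙ g ∙ h     ≈⟨ assoc _ _ _ ⟩
    h ⁻¹ ∙ (g ⁻¹ ∙ x) ∙ (g ∙ h)   ≈⟨ ∙-congʳ (assoc _ _ _) ⟨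
    h ⁻¹ ∙ g ⁻¹ ∙ x ∙ (g ∙ h)     ≈⟨ ∙-congʳ (∙-congʳ (⁻¹-anti-homo-∙ g h)) ⟨
    (g ∙ h) ⁻¹ ∙ x ∙ (g ∙ h)      ∎

  ^-identity : ∀ x → x ^ᵍ ε ≈ x
  ^-identity x = trans (identityʳ _) (trans (∙-congʳ ε⁻¹≈ε) (identityˡ x))

  ^-inverseˡ : ∀ x g → (x ^ᵍ (g ⁻¹)) ^ᵍ g ≈ x
  ^-inverseˡ x g = trans (^-assoc x (g ⁻¹) g) (trans (^-cong refl (inverseˡ g)) (^-identity x))

  ^-inverseʳ : ∀ x g → (x ^ᵍ g) ^ᵍ (g ⁻¹) ≈ x
  ^-inverseʳ x g = trans (^-assoc x g (g ⁻¹)) (trans (^-cong refl (inverseʳ g)) (^-identity x))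

  ^⁻¹-∙ : ∀ x g → x ^ᵍ (g ⁻¹) ∙ g ≈ g ∙ x
  ^⁻¹-∙ x g = trans (//-rightDividesˡ g _) (∙-congʳ (⁻¹-involutive g))

  \\-cancel : ∀ x y z → (z ∙ x) ⁻¹ ∙ (z ∙ y) ≈ x ⁻¹ ∙ y
  \\-cancel x y z = begin
    (z ∙ x) ⁻¹ ∙ (z ∙ y)      ≈⟨ ∙-congʳ (⁻¹-anti-homo-∙ z x) ⟩
    x ⁻¹ ∙ z ⁻¹ ∙ (z ∙ y)     ≈⟨ assoc _ _ _ ⟩
    x ⁻¹ ∙ (z ⁻¹ ∙ (z ∙ y))   ≈⟨ ∙-congˡ (\\-leftDividesʳ z y) ⟩
    x ⁻¹ ∙ y                  ∎

  \\-translate : ∀ x y z → (x ∙ z) ⁻¹ ∙ (y ∙ z) ≈ (x ⁻¹ ∙ y) ^ᵍ z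
  \\-translate x y z = begin
    (x ∙ z) ⁻¹ ∙ (y ∙ z)      ≈⟨ ∙-congʳ (⁻¹-anti-homo-∙ x z) ⟩
    z ⁻¹ ∙ x ⁻¹ ∙ (y ∙ z)     ≈⟨ assoc _ _ _ ⟨
    z ⁻¹ ∙ x ⁻¹ ∙ y ∙ z       ≈⟨ ∙-congʳ (assoc _ _ _) ⟩
    z ⁻¹ ∙ (x ⁻¹ ∙ y) ∙ z     ∎

module Subgroups {ℓ : Level} (G : Group ℓ ℓ) where
  open Group G
  open GroupProperties G
  open Conjugation G
  open Subgroup

  infix 4 _∈ˢ_ _≤_ _≈ˢ_

  _∈ˢ_ : Carrier → Subgroup G → Set ℓ
  x ∈ˢ H = x ∈ elements H

  _≤_ : Subgroup G → Subgroup G → Set ℓ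
  I ≤ H = elements I ⊆ elements H

  _≈ˢ_ : Subgroup G → Subgroup G → Set ℓ
  I ≈ˢ H = elements I ≐ elements H

  infixr 7 _∩ˢ_

  _∩ˢ_ : Subgroup G → Subgroup G → Subgroup G
  I ∩ˢ J = record
    { elements = elements I ∩ elements J
    ; resp   = λ { p (x∈I , x∈J) → resp I p x∈I , resp J p x∈J }
    ; ε-mem  = ε-mem I , ε-mem J
    ; ∙-mem  = λ { (x∈I , x∈J) (y∈I , y∈J) → ∙-mem I x∈I y∈I , ∙-mem J x∈J y∈J }
    ; ⁻¹-mem = λ { (x∈I , x∈J) → ⁻¹-mem I x∈I , ⁻¹-mem J x∈J }
    }

  infixr 8 _▹_
  infixl 8 _◃_

  -- ᵍH = gHg⁻¹, described by x ∈ gHg⁻¹ ⇔ g⁻¹xg ∈ H.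
  _▹_ : Carrier → Subgroup G → Subgroup G
  g ▹ H = record
    { elements = λ x → x ^ᵍ g ∈ˢ H
    ; resp   = λ p → resp H (^-cong p refl)
    ; ε-mem  = resp H (sym (^-ε g)) (ε-mem H)
    ; ∙-mem  = λ {x} {y} p q → resp H (sym (^-∙ x y g)) (∙-mem H p q)
    ; ⁻¹-mem = λ {x} p → resp H (sym (^-⁻¹ x g)) (⁻¹-mem H p)
    }

  -- Hᵍ = g⁻¹Hg
  _◃_ : Subgroup G → Carrier → Subgroup G
  H ◃ g = (g ⁻¹) ▹ H

  Normal : Subgroup G → Set ℓ
  Normal H = ∀ g → H ≈ˢ g ▹ H

  infix 9 _⧸_ _⧹_⧸_

  -- Both quotients are taken of the set of elements of H:
  -- xI = yI ⇔ x⁻¹y ∈ I, and IxJ = IyJ ⇔ x ∈ IyJ.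

  _⧸_ : Subgroup G → Subgroup G → Setoid ℓ ℓ
  H ⧸ I = record
    { Carrier = Σ Carrier (_∈ˢ H)
    ; _≈_ = λ x y → proj₁ x ⁻¹ ∙ proj₁ y ∈ˢ I
    ; isEquivalence = record
      { refl  = resp I (sym (inverseˡ _)) (ε-mem I)
      ; sym   = λ {x} {y} p → resp I (⁻¹-anti-homo-\\ (proj₁ x) (proj₁ y)) (⁻¹-mem I p)
      ; trans = λ {x} {y} {z} p q → resp I
          (trans (assoc _ _ _) (∙-congˡ (\\-leftDividesˡ (proj₁ y) (proj₁ z)))) (∙-mem I p q)
      }
    }

  _⧹_⧸_ : Subgroup G → Subgroup G → Subgroup G → Setoid ℓ ℓ
  I ⧹ H ⧸ J = record
    { Carrier = Σ Carrier (_∈ˢ H)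
    ; _≈_ = λ x y → ∃₂ λ i j → i ∈ˢ I × j ∈ˢ J × proj₁ x ≈ i ∙ proj₁ y ∙ j
    ; isEquivalence = record
      { refl  = ε , ε , ε-mem I , ε-mem J , sym (trans (identityʳ _) (identityˡ _))
      ; sym   = λ { {x , _} {y , _} (i , j , i∈I , j∈J , p) →
          i ⁻¹ , j ⁻¹ , ⁻¹-mem I i∈I , ⁻¹-mem J j∈J , (begin
            y                            ≈⟨ //-rightDividesʳ j y ⟨
            y ∙ j ∙ j ⁻¹                 ≈⟨ ∙-congʳ (\\-leftDividesʳ i (y ∙ j)) ⟨
            i ⁻¹ ∙ (i ∙ (y ∙ j)) ∙ j ⁻¹  ≈⟨ ∙-congʳ (∙-congˡ (assoc _ _ _)) ⟨
            i ⁻¹ ∙ (i ∙ y ∙ j) ∙ j ⁻¹    ≈⟨ ∙-congʳ (∙-congˡ p) ⟨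
            i ⁻¹ ∙ x ∙ j ⁻¹              ∎) }
      ; trans = λ { {x , _} {y , _} {z , _} (i , j , i∈I , j∈J , p) (i′ , j′ , i′∈I , j′∈J , q) →
          i ∙ i′ , j′ ∙ j , ∙-mem I i∈I i′∈I , ∙-mem J j′∈J j∈J , (begin
            x                            ≈⟨ p ⟩
            i ∙ y ∙ j                    ≈⟨ ∙-congʳ (∙-congˡ q) ⟩
            i ∙ (i′ ∙ z ∙ j′) ∙ j        ≈⟨ ∙-congʳ (assoc _ _ _) ⟨
            i ∙ (i′ ∙ z) ∙ j′ ∙ j        ≈⟨ assoc _ _ _ ⟩
            i ∙ (i′ ∙ z) ∙ (j′ ∙ j)      ≈⟨ ∙-congʳ (assoc _ _ _) ⟨
            i ∙ i′ ∙ z ∙ (j′ ∙ j)        ∎) }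
      }
    }
    where open SetoidReasoning setoid

  ▹-self : ∀ H {h} → h ∈ˢ H → h ▹ H ≈ˢ H
  ▹-self H {h} h∈H =
      (λ {x} p → resp H (^-inverseʳ x h) (∙-mem H (∙-mem H (⁻¹-mem H (⁻¹-mem H h∈H)) p) (⁻¹-mem H h∈H)))
    , (λ p → ∙-mem H (∙-mem H (⁻¹-mem H h∈H) p) h∈H)

  ▹-∩-◃ : ∀ I J h → I ∩ˢ (h ▹ J) ≈ˢ h ▹ ((I ◃ h) ∩ˢ J)
  ▹-∩-◃ I J h =
      (λ { {x} (p , q) → resp I (sym (^-inverseʳ x h)) p , q })
    , (λ { {x} (p , q) → resp I (^-inverseʳ x h) p , q })

data Kind : Set where
  𝐫 𝐢 : Kind

-- Base is 𝔖_b and Sub ⋆ H is 𝔖_⋆(H).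
record SubgroupSystem {ℓ : Level} (G : Group ℓ ℓ) : Set (lsuc (lsuc ℓ)) where
  open Group G using (Carrier)
  open Subgroups G
  field
    Base          : Pred (Subgroup G) (lsuc ℓ)
    Base-resp     : Base Respects _≈ˢ_
    Base-nonempty : ∃ Base
    Base-conj     : ∀ g {H} → H ∈ Base → g ▹ H ∈ Base

  𝔅 : Set (lsuc ℓ)
  𝔅 = ∃ Base

  ⟦_⟧ : 𝔅 → Subgroup G
  ⟦ H ⟧ = proj₁ H

  infixr 8 _▸_

  _▸_ : Carrier → 𝔅 → 𝔅
  g ▸ (H , H∈) = g ▹ H , Base-conj g H∈

  field
    Sub       : Kind → 𝔅 → Pred (Subgroup G) (lsuc ℓ)
    Sub-resp  : ∀ ⋆ H H′ {I I′} → ⟦ H ⟧ ≈ˢ ⟦ H′ ⟧ → I ≈ˢ I′ → I ∈ Sub ⋆ H → I′ ∈ Sub ⋆ H′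
    Sub-base  : ∀ ⋆ H → Sub ⋆ H ⊆ Base
    Sub-≤     : ∀ ⋆ H {I} → I ∈ Sub ⋆ H → I ≤ ⟦ H ⟧
    Sub-refl  : ∀ ⋆ H → ⟦ H ⟧ ∈ Sub ⋆ H
    Sub-trans : ∀ ⋆ H I → ⟦ I ⟧ ∈ Sub ⋆ H → Sub ⋆ I ⊆ Sub ⋆ H
    Sub-conj  : ∀ ⋆ g H → (λ K → ∃ λ I → I ∈ Sub ⋆ H × K ≈ˢ g ▹ I) ≐ Sub ⋆ (g ▸ H)

module _ {ℓ : Level} {G : Group ℓ ℓ} (𝔖 : SubgroupSystem G) where
  open Group G using (_⁻¹)
  open Subgroups G
  open SubgroupSystem 𝔖

  IFinite : Set (lsuc ℓ)
  IFinite = ∀ H I → I ∈ Sub 𝐢 H → Finite (⟦ H ⟧ ⧸ I)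

  record IsMackeySystem : Set (lsuc ℓ) where
    field
      finite : ∀ H I J → ⟦ I ⟧ ∈ Sub 𝐫 H → ⟦ J ⟧ ∈ Sub 𝐢 H → Finite (⟦ I ⟧ ⧹ ⟦ H ⟧ ⧸ ⟦ J ⟧)
      ∩-𝐫    : ∀ H I J → ⟦ I ⟧ ∈ Sub 𝐫 H → ⟦ J ⟧ ∈ Sub 𝐢 H → ⟦ I ⟧ ∩ˢ ⟦ J ⟧ ∈ Sub 𝐫 J
      ∩-𝐢    : ∀ H I J → ⟦ I ⟧ ∈ Sub 𝐫 H → ⟦ J ⟧ ∈ Sub 𝐢 H → ⟦ I ⟧ ∩ˢ ⟦ J ⟧ ∈ Sub 𝐢 I

    Sub-▹ : ∀ ⋆ H I {h} → h ∈ˢ ⟦ H ⟧ → ⟦ I ⟧ ∈ Sub ⋆ H → h ▹ ⟦ I ⟧ ∈ Sub ⋆ H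
    Sub-▹ ⋆ H I {h} h∈H I∈ = Sub-resp ⋆ (h ▸ H) H {h ▹ ⟦ I ⟧} (▹-self ⟦ H ⟧ h∈H) ((λ p → p) , (λ p → p))
      (proj₁ (Sub-conj ⋆ h H) (⟦ I ⟧ , I∈ , (λ p → p) , (λ p → p)))

    module _ H I J (I∈ : ⟦ I ⟧ ∈ Sub 𝐫 H) (J∈ : ⟦ J ⟧ ∈ Sub 𝐢 H) {h} (h∈H : h ∈ˢ ⟦ H ⟧) where

      ∩▹-𝐢 : ⟦ I ⟧ ∩ˢ (h ▹ ⟦ J ⟧) ∈ Sub 𝐢 I
      ∩▹-𝐢 = ∩-𝐢 H I (h ▸ J) I∈ (Sub-▹ 𝐢 H J h∈H J∈)

      ◃∩-𝐫 : (⟦ I ⟧ ◃ h) ∩ˢ ⟦ J ⟧ ∈ Sub 𝐫 J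
      ◃∩-𝐫 = ∩-𝐫 H ((h ⁻¹) ▸ I) J (Sub-▹ 𝐫 H I (Subgroup.⁻¹-mem ⟦ H ⟧ h∈H) I∈) J∈

      ∩▹ : 𝔅
      ∩▹ = ⟦ I ⟧ ∩ˢ (h ▹ ⟦ J ⟧) , Sub-base 𝐢 I ∩▹-𝐢

      ◃∩ : 𝔅
      ◃∩ = (⟦ I ⟧ ◃ h) ∩ˢ ⟦ J ⟧ , Sub-base 𝐫 J ◃∩-𝐫

record MackeySystem {ℓ : Level} (G : Group ℓ ℓ) : Set (lsuc (lsuc ℓ)) where
  field
    system         : SubgroupSystem G
    isMackeySystem : IsMackeySystem system
  open SubgroupSystem system public
  open IsMackeySystem isMackeySystem public

-- The base of a subgroup system need not be small, so colimits over subsets of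
-- it leave the universe of G; abelian groups are taken in any universe large
-- enough to be closed under them.
Ab : (ℓ a : Level) → Set (lsuc (lsuc ℓ ⊔ a))
Ab ℓ a = AbelianGroup (lsuc ℓ ⊔ a) (lsuc ℓ ⊔ a)

module _ {ℓ : Level} {G : Group ℓ ℓ} (𝔐 : MackeySystem G) (a : Level) where
  open Group G using (Carrier; _∙_) renaming (_≈_ to _≈ᴳ_)
  open Subgroups G
  open MackeySystem 𝔐

  -- Subgroups are predicates, equal when they have the same elements, and a
  -- family Φ(H) has to respect this equality.  So con_{g,H} is given as a map
  -- Φ(H) → Φ(K) for every K equal to ᵍH, and all laws hold for every such
  -- choice.  For g = ε this is the identification Φ(H) = Φ(K) for H equal to K.
  record MackeyFunctor : Set (lsuc (lsuc ℓ ⊔ a)) where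
    field
      Φ   : 𝔅 → Ab ℓ a
      res : ∀ I H → ⟦ I ⟧ ∈ Sub 𝐫 H → Φ H ⟶ Φ I
      ind : ∀ H I → ⟦ I ⟧ ∈ Sub 𝐢 H → Φ I ⟶ Φ H
      con : ∀ g H K → ⟦ K ⟧ ≈ˢ g ▹ ⟦ H ⟧ → Φ H ⟶ Φ K

    infix 4 _≈_

    _≈_ : ∀ {H} → Rel (AbelianGroup.Carrier (Φ H)) (lsuc ℓ ⊔ a)
    _≈_ {H} = AbelianGroup._≈_ (Φ H)

    field
      res-id  : ∀ H p x → res H H p $ x ≈ x
      ind-id  : ∀ H p x → ind H H p $ x ≈ x
      con-id  : ∀ h H p → h ∈ˢ ⟦ H ⟧ → ∀ x → con h H H p $ x ≈ x
      res-res : ∀ J I H p q r x → res J I p $ (res I H q $ x) ≈ res J H r $ x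
      ind-ind : ∀ H I J p q r x → ind H I p $ (ind I J q $ x) ≈ ind H J r $ x
      con-con : ∀ g′ g H K L p q r x → con g′ K L p $ (con g H K q $ x) ≈ con (g′ ∙ g) H L r $ x
      con-≈   : ∀ g g′ H K p q → g ≈ᴳ g′ → ∀ x → con g H K p $ x ≈ con g′ H K q $ x
      con-res : ∀ g I H gI gH p q r s x →
                con g I gI p $ (res I H q $ x) ≈ res gI gH r $ (con g H gH s $ x)
      con-ind : ∀ g H I gH gI p q r s x →
                con g H gH p $ (ind H I q $ x) ≈ ind gH gI r $ (con g I gI s $ x)
      mackey  : ∀ H I J (I∈ : ⟦ I ⟧ ∈ Sub 𝐫 H) (J∈ : ⟦ J ⟧ ∈ Sub 𝐢 H)
                {n : ℕ} (R : Enumeration n (⟦ I ⟧ ⧹ ⟦ H ⟧ ⧸ ⟦ J ⟧)) x →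
                res I H I∈ $ (ind H J J∈ $ x) ≈
                ∑ (Φ I) (λ k → let (h , h∈H) = Inverse.to R k in
                  ind I (∩▹ H I J I∈ J∈ h∈H) (∩▹-𝐢 H I J I∈ J∈ h∈H) $
                  (con h (◃∩ H I J I∈ J∈ h∈H) (∩▹ H I J I∈ J∈ h∈H) (▹-∩-◃ ⟦ I ⟧ ⟦ J ⟧ h) $
                  (res (◃∩ H I J I∈ J∈ h∈H) J (◃∩-𝐫 H I J I∈ J∈ h∈H) $ x)))

  module _ (Φ Ψ : MackeyFunctor) where
    private
      module Φ = MackeyFunctor Φ
      module Ψ = MackeyFunctor Ψ

    record MackeyMorphism : Set (lsuc ℓ ⊔ a) where
      field
        φ     : ∀ H → Φ.Φ H ⟶ Ψ.Φ H
        φ-res : ∀ I H p x → φ I $ (Φ.res I H p $ x) Ψ.≈ Ψ.res I H p $ (φ H $ x)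
        φ-ind : ∀ H I p x → φ H $ (Φ.ind H I p $ x) Ψ.≈ Ψ.ind H I p $ (φ I $ x)
        φ-con : ∀ g H K p x → φ K $ (Φ.con g H K p $ x) Ψ.≈ Ψ.con g H K p $ (φ H $ x)

  open MackeyMorphism

  Mack : Category (lsuc (lsuc ℓ ⊔ a)) (lsuc ℓ ⊔ a) (lsuc ℓ ⊔ a)
  Mack = record
    { Obj = MackeyFunctor
    ; _⇒_ = MackeyMorphism
    ; _≈_ = λ {Φ} {Ψ} f g → ∀ H x → MackeyFunctor._≈_ Ψ {H} (φ f H $ x) (φ g H $ x)
    ; isEquivalence = λ {Φ} {Ψ} → record
      { refl  = λ H x → AG.refl (M.Φ Ψ H)
      ; sym   = λ p H x → AG.sym (M.Φ Ψ H) (p H x)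
      ; trans = λ p q H x → AG.trans (M.Φ Ψ H) (p H x) (q H x)
      }
    ; idᶜ = λ {Φ} → record
      { φ     = λ H → id⟶ {A = M.Φ Φ H}
      ; φ-res = λ I H p x → AG.refl (M.Φ Φ I)
      ; φ-ind = λ H I p x → AG.refl (M.Φ Φ H)
      ; φ-con = λ g H K p x → AG.refl (M.Φ Φ K)
      }
    ; _∘ᶜ_ = λ {Φ} {Ψ} {Χ} f g → record
      { φ     = λ H → _∘⟶_ {A = M.Φ Φ H} {M.Φ Ψ H} {M.Φ Χ H} (φ f H) (φ g H)
      ; φ-res = λ I H p x → AG.trans (M.Φ Χ I) (cong (φ f I) (φ-res g I H p x)) (φ-res f I H p _)
      ; φ-ind = λ H I p x → AG.trans (M.Φ Χ H) (cong (φ f H) (φ-ind g H I p x)) (φ-ind f H I p _)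
      ; φ-con = λ g₁ H K p x → AG.trans (M.Φ Χ K) (cong (φ f K) (φ-con g g₁ H K p x)) (φ-con f g₁ H K p _)
      }
    ; ∘-resp-≈ = λ {_} {_} {Χ} {f} p q H x →
        AG.trans (M.Φ Χ H) (cong (φ f H) (q H x)) (p H _)
    ; identityˡ = λ {_} {Ψ} f H x → AG.refl (M.Φ Ψ H)
    ; identityʳ = λ {_} {Ψ} f H x → AG.refl (M.Φ Ψ H)
    ; assoc = λ {_} {_} {_} {Χ} f g h H x → AG.refl (M.Φ Χ H)
    }
    where
    open GroupHomomorphism using () renaming (⟦⟧-cong to cong)
    module M = MackeyFunctor
    module AG = AbelianGroup

record TopologicalGroup (ℓ : Level) : Set (lsuc (lsuc ℓ)) where
  field
    group : Group ℓ ℓ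
  open Group group public
  field
    IsOpen     : Pred Carrier ℓ → Set (lsuc ℓ)
    open-≈     : ∀ {U} → IsOpen U → U Respects _≈_
    open-whole : IsOpen (λ _ → ⊤)
    open-∩     : ∀ {U V} → IsOpen U → IsOpen V → IsOpen (U ∩ V)
    -- Any subset equal to a union of open subsets; the family may be large.
    open-⋃     : ∀ {I : Set (lsuc ℓ)} (U : I → Pred Carrier ℓ) → (∀ i → IsOpen (U i)) →
                 ∀ {V : Pred Carrier ℓ} → V ≐ ⋃ I U → IsOpen V
    ∙-continuous  : ∀ {U} → IsOpen U → ∀ x y → x ∙ y ∈ U →
                    ∃₂ λ V W → IsOpen V × IsOpen W × x ∈ V × y ∈ W ×
                               (∀ {v w} → v ∈ V → w ∈ W → v ∙ w ∈ U)
    ⁻¹-continuous : ∀ {U} → IsOpen U → IsOpen (λ x → x ⁻¹ ∈ U)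

module _ {ℓ : Level} (G : TopologicalGroup ℓ) (a : Level) where
  private module G = TopologicalGroup G

  record DiscreteModule : Set (lsuc (lsuc ℓ ⊔ a)) where
    infixr 8 _·_
    field
      abelianGroup : Ab ℓ a
    open AbelianGroup abelianGroup public
      renaming (_∙_ to _+_; ε to 0#; _⁻¹ to -_; ∙-cong to +-cong)
    field
      _·_    : G.Carrier → Carrier → Carrier
      ·-cong : ∀ {g h x y} → g G.≈ h → x ≈ y → g · x ≈ h · y
      ·-+    : ∀ g x y → g · (x + y) ≈ g · x + g · y
      ·-ε    : ∀ x → G.ε · x ≈ x
      ·-∙    : ∀ g h x → (g G.∙ h) · x ≈ g · (h · x)
      -- continuity of G × A → A for the discrete topology on A
      ·-continuous : ∀ g x → ∃ λ V → G.IsOpen V × g ∈ V × (∀ {v} → v ∈ V → v · x ≈ g · x)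

  record ModuleMorphism (A B : DiscreteModule) : Set (lsuc ℓ ⊔ a) where
    private
      module A = DiscreteModule A
      module B = DiscreteModule B
    field
      hom         : A.abelianGroup ⟶ B.abelianGroup
      equivariant : ∀ g x → hom $ (g A.· x) B.≈ g B.· (hom $ x)

  open ModuleMorphism

  GAbᵈ : Category (lsuc (lsuc ℓ ⊔ a)) (lsuc ℓ ⊔ a) (lsuc ℓ ⊔ a)
  GAbᵈ = record
    { Obj = DiscreteModule
    ; _⇒_ = ModuleMorphism
    ; _≈_ = λ {A} {B} f g → ∀ x → DiscreteModule._≈_ B (hom f $ x) (hom g $ x)
    ; isEquivalence = λ {A} {B} → record
      { refl  = λ x → DiscreteModule.refl B
      ; sym   = λ p x → DiscreteModule.sym B (p x)
      ; trans = λ p q x → DiscreteModule.trans B (p x) (q x)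
      }
    ; idᶜ = λ {A} → record
      { hom         = id⟶ {A = DiscreteModule.abelianGroup A}
      ; equivariant = λ g x → DiscreteModule.refl A
      }
    ; _∘ᶜ_ = λ {A} {B} {C} f g → record
      { hom = _∘⟶_ {A = DiscreteModule.abelianGroup A} {DiscreteModule.abelianGroup B} {DiscreteModule.abelianGroup C} (hom f) (hom g)
      ; equivariant = λ h x → DiscreteModule.trans C (cong (hom f) (equivariant g h x)) (equivariant f h _)
      }
    ; ∘-resp-≈ = λ {_} {_} {C} {f} p q x → DiscreteModule.trans C (cong (hom f) (q x)) (p _)
    ; identityˡ = λ {_} {B} f x → DiscreteModule.refl B
    ; identityʳ = λ {_} {B} f x → DiscreteModule.refl B
    ; assoc = λ {_} {_} {_} {D} f g h x → DiscreteModule.refl D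
    }
    where open GroupHomomorphism using () renaming (⟦⟧-cong to cong)

record DescentBasis {ℓ : Level} (G : TopologicalGroup ℓ)
  (𝔐 : MackeySystem (TopologicalGroup.group G)) : Set (lsuc (lsuc ℓ)) where
  open TopologicalGroup G using (group; IsOpen)
  open Subgroups group
  open MackeySystem 𝔐
  field
    𝒰         : Pred 𝔅 (lsuc ℓ)
    𝒰-resp    : ∀ U V → ⟦ U ⟧ ≈ˢ ⟦ V ⟧ → U ∈ 𝒰 → V ∈ 𝒰
    open-𝒰    : ∀ U → U ∈ 𝒰 → IsOpen (Subgroup.elements ⟦ U ⟧)
    normal-𝒰  : ∀ U → U ∈ 𝒰 → Normal ⟦ U ⟧
    nonempty  : ∃ λ U → U ∈ 𝒰
    directed  : ∀ U V → U ∈ 𝒰 → V ∈ 𝒰 → ∃ λ W → W ∈ 𝒰 × ⟦ W ⟧ ≤ ⟦ U ⟧ ∩ˢ ⟦ V ⟧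
    𝒰⊆𝐫       : ∀ H U → U ∈ 𝒰 → ⟦ U ⟧ ≤ ⟦ H ⟧ → ⟦ U ⟧ ∈ Sub 𝐫 H
    below     : ∀ H → ∃ λ U → U ∈ 𝒰 × ⟦ U ⟧ ≤ ⟦ H ⟧

module _ {ℓ : Level} {a : Level} {G : TopologicalGroup ℓ} (A : DiscreteModule G a) where
  open DiscreteModule A
  private module G = TopologicalGroup G
  open Subgroups G.group

  Fixed : Subgroup G.group → Pred Carrier (lsuc ℓ ⊔ a)
  Fixed H x = ∀ {h} → h ∈ˢ H → h · x ≈ x

  act : G.Carrier → abelianGroup ⟶ abelianGroup
  act g = mkHom abelianGroup abelianGroup (g ·_) (·-cong G.refl) (·-+ g)

  private
    module act g = GroupHomomorphism (act g)

    rawInvariants : Subgroup G.group → RawGroup (lsuc ℓ ⊔ a) (lsuc ℓ ⊔ a)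
    rawInvariants H = record
      { Carrier = ∃ (Fixed H)
      ; _≈_ = λ x y → proj₁ x ≈ proj₁ y
      ; _∙_ = λ { (x , p) (y , q) → x + y , λ h∈ → trans (·-+ _ x y) (+-cong (p h∈) (q h∈)) }
      ; ε   = 0# , λ _ → act.ε-homo _
      ; _⁻¹ = λ { (x , p) → - x , λ h∈ → trans (act.⁻¹-homo _ x) (⁻¹-cong (p h∈)) }
      }

  invariants : Subgroup G.group → Ab ℓ a
  invariants H = record
    { RawGroup (rawInvariants H)
    ; isAbelianGroup = GroupMono.isAbelianGroup mono isAbelianGroup
    }
    where
    mono : IsGroupMonomorphism (rawInvariants H) rawGroup proj₁
    mono = record
      { isGroupHomomorphism = record
        { isMonoidHomomorphism = record
          { isMagmaHomomorphism = record
            { isRelHomomorphism = record { cong = λ p → p } ; homo = λ _ _ → refl }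
          ; ε-homo = refl
          }
        ; ⁻¹-homo = λ _ → refl
        }
      ; injective = λ p → p
      }

  inclusion : ∀ H → invariants H ⟶ abelianGroup
  inclusion H = mkHom (invariants H) abelianGroup proj₁ (λ p → p) (λ _ _ → refl)

  orbit : ∀ H I → ∃ (Fixed I) → Setoid.Carrier (H ⧸ I) → Carrier
  orbit H I (x , _) (h , _) = h · x

  orbit-cong : ∀ H I x {h h′} → Setoid._≈_ (H ⧸ I) h h′ → orbit H I x h ≈ orbit H I x h′
  orbit-cong H I (x , p) {h , _} {h′ , _} r = sym (begin
    h′ · x                     ≈⟨ ·-cong (\\-leftDividesˡ h h′) refl ⟨
    (h G.∙ (h G.⁻¹ G.∙ h′)) · x    ≈⟨ ·-∙ h (h G.⁻¹ G.∙ h′) x ⟩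
    h · (h G.⁻¹ G.∙ h′) · x      ≈⟨ ·-cong G.refl (p r) ⟩
    h · x                      ∎)
    where
    open SetoidReasoning setoid
    open GroupProperties G.group using (\\-leftDividesˡ)

module Invariants {ℓ : Level} {G : TopologicalGroup ℓ}
  (𝔐 : MackeySystem (TopologicalGroup.group G)) (ifin : IFinite (MackeySystem.system 𝔐))
  {a : Level} (A : DiscreteModule G a) where
  open DiscreteModule A hiding (inverseˡ; inverseʳ)
  private module G = TopologicalGroup G
  open Subgroups G.group
  open Subgroup
  open Conjugation G.group
  open MackeySystem 𝔐
  open SetoidReasoning setoid
  open GroupProperties G.group using (\\-leftDividesˡ; \\-leftDividesʳ)
  open SumProperties abelianGroup
  open Summation commutativeMonoid using (sum-cong-≋)
  open Inverse using (to; from; to-cong; from-cong; strictlyInverseˡ; strictlyInverseʳ)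

  private
    A^_ : 𝔅 → Ab ℓ a
    A^ H = invariants A ⟦ H ⟧

    coset-∑ : ∀ H I {n : ℕ} → Enumeration n (H ⧸ I) → ∃ (Fixed A I) → Carrier
    coset-∑ H I e x = ∑ abelianGroup (λ k → orbit A H I x (to e k))

    ·-∑ : ∀ g {n : ℕ} (t : Fin n → Carrier) →
          g · ∑ abelianGroup t ≈ ∑ abelianGroup (λ k → g · t k)
    ·-∑ g t = hom-∑ {A = abelianGroup} {abelianGroup} (act A g) t

    translation : ∀ H I {h} → h ∈ˢ H → Inverse (H ⧸ I) (H ⧸ I)
    translation H I {h} h∈H = record
      { to = λ { (x , x∈H) → h G.∙ x , ∙-mem H h∈H x∈H }
      ; from = λ { (x , x∈H) → h G.⁻¹ G.∙ x , ∙-mem H (⁻¹-mem H h∈H) x∈H }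
      ; to-cong = λ {x} {y} p → resp I (G.sym (\\-cancel (proj₁ x) (proj₁ y) h)) p
      ; from-cong = λ {x} {y} p → resp I (G.sym (\\-cancel (proj₁ x) (proj₁ y) (h G.⁻¹))) p
      ; inverse =
          (λ {x} {y} p → resp I (G.trans (G.sym (\\-cancel _ _ h)) (G.∙-congˡ (\\-leftDividesˡ h (proj₁ x)))) p)
        , (λ {x} {y} p → resp I (G.trans (G.sym (\\-cancel _ _ (h G.⁻¹))) (G.∙-congˡ (\\-leftDividesʳ h (proj₁ x)))) p)
      }

    fixed-∑ : ∀ H I {n : ℕ} (e : Enumeration n (H ⧸ I)) x → coset-∑ H I e x ∈ Fixed A H
    fixed-∑ H I e x {h} h∈H = begin
      h · coset-∑ H I e x
        ≈⟨ ·-∑ h (λ k → orbit A H I x (to e k)) ⟩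
      ∑ abelianGroup (λ k → h · orbit A H I x (to e k))
        ≈⟨ sum-cong-≋ (λ k → ·-∙ h (proj₁ (to e k)) (proj₁ x)) ⟨
      ∑ abelianGroup (λ k → orbit A H I x (to (translation H I h∈H) (to e k)))
        ≈⟨ ∑-bijection (H ⧸ I) (orbit A H I x) (λ {h} {h′} → orbit-cong A H I x {h} {h′}) (translation H I h∈H) e e ⟨
      coset-∑ H I e x ∎

    singleton : ∀ H → Enumeration 1 (H ⧸ H)
    singleton H = record
      { to = λ _ → G.ε , ε-mem H
      ; from = λ _ → zero
      ; to-cong = λ _ → resp H (G.sym (G.inverseˡ _)) (ε-mem H)
      ; from-cong = λ _ → ≡.refl
      ; inverse = (λ {x} _ → ∙-mem H (⁻¹-mem H (ε-mem H)) (proj₂ x)) , λ { {zero} _ → ≡.refl }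
      }

  res : ∀ I H → ⟦ I ⟧ ∈ Sub 𝐫 H → (A^ H) ⟶ (A^ I)
  res I H I∈ = mkHom (A^ H) (A^ I)
    (λ { (x , p) → x , λ h∈I → p (Sub-≤ 𝐫 H {⟦ I ⟧} I∈ h∈I) }) (λ p → p) (λ _ _ → refl)

  ind : ∀ H I → ⟦ I ⟧ ∈ Sub 𝐢 H → (A^ I) ⟶ (A^ H)
  ind H I I∈ = mkHom (A^ I) (A^ H)
    (λ x → ∑ abelianGroup (λ k → orbit A ⟦ H ⟧ ⟦ I ⟧ x (to e k)) , fixed-∑ ⟦ H ⟧ ⟦ I ⟧ e x)
    (λ p → sum-cong-≋ {proj₁ fin} (λ k → ·-cong G.refl p))
    (λ x y → trans (sum-cong-≋ {proj₁ fin} (λ k → ·-+ (proj₁ (to e k)) (proj₁ x) (proj₁ y)))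
                   (∑-distrib-+ (λ k → orbit A ⟦ H ⟧ ⟦ I ⟧ x (to e k)) (λ k → orbit A ⟦ H ⟧ ⟦ I ⟧ y (to e k))))
    where
    open Summation commutativeMonoid using (∑-distrib-+)
    fin = ifin H ⟦ I ⟧ I∈
    e = proj₂ fin

  con : ∀ g H K → ⟦ K ⟧ ≈ˢ g ▹ ⟦ H ⟧ → (A^ H) ⟶ (A^ K)
  con g H K K≈gH = mkHom (A^ H) (A^ K)
    (λ { (x , p) → g · x , λ {k} k∈K → begin
        k · g · x                        ≈⟨ ·-∙ k g x ⟨
        (k G.∙ g) · x                    ≈⟨ ·-cong (G.trans (G.sym (\\-leftDividesˡ g (k G.∙ g))) (G.∙-congˡ (G.sym (G.assoc _ _ _)))) refl ⟩
        (g G.∙ (k ^ᵍ g)) · x             ≈⟨ ·-∙ g (k ^ᵍ g) x ⟩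
        g · (k ^ᵍ g) · x                 ≈⟨ ·-cong G.refl (p (proj₁ K≈gH k∈K)) ⟩
        g · x                            ∎ })
    (·-cong G.refl) (λ x y → ·-+ g (proj₁ x) (proj₁ y))

  private
    ind-id : ∀ H p x → proj₁ (ind H H p $ x) ≈ proj₁ x
    ind-id H p x = begin
      coset-∑ ⟦ H ⟧ ⟦ H ⟧ e x
        ≈⟨ ∑-bijection (⟦ H ⟧ ⧸ ⟦ H ⟧) (orbit A ⟦ H ⟧ ⟦ H ⟧ x) (λ {h} {h′} → orbit-cong A ⟦ H ⟧ ⟦ H ⟧ x {h} {h′}) (Identity.inverse _) e (singleton ⟦ H ⟧) ⟩
      G.ε · proj₁ x + 0#
        ≈⟨ identityʳ _ ⟩
      G.ε · proj₁ x
        ≈⟨ ·-ε (proj₁ x) ⟩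
      proj₁ x ∎
      where e = proj₂ (ifin H ⟦ H ⟧ p)

    ind-ind : ∀ H I J p q r x → proj₁ (ind H I p $ (ind I J q $ x)) ≈ proj₁ (ind H J r $ x)
    ind-ind H I J p q r x = sym (begin
      coset-∑ ⟦ H ⟧ ⟦ J ⟧ eHJ x
        ≈⟨ ∑-fibres (⟦ H ⟧ ⧸ ⟦ J ⟧) (orbit A ⟦ H ⟧ ⟦ J ⟧ x) (λ {h} {h′} → orbit-cong A ⟦ H ⟧ ⟦ J ⟧ x {h} {h′}) eHJ (λ _ → eIJ)
             ψ (λ k {y} {z} → resp ⟦ J ⟧ (G.sym (\\-cancel (proj₁ y) (proj₁ z) (h k)))) surj
             (λ {k} {l} {k′} {l′} s → inj₁ k (to eIJ l) k′ (to eIJ l′) s)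
             (λ {k} {y} {z} → resp ⟦ J ⟧ (\\-cancel (proj₁ y) (proj₁ z) (h k))) ⟩
      ∑ abelianGroup (λ k → ∑ abelianGroup (λ l → (h k G.∙ proj₁ (to eIJ l)) · proj₁ x))
        ≈⟨ sum-cong-≋ (λ k → sum-cong-≋ (λ l → ·-∙ (h k) (proj₁ (to eIJ l)) (proj₁ x))) ⟩
      ∑ abelianGroup (λ k → ∑ abelianGroup (λ l → h k · proj₁ (to eIJ l) · proj₁ x))
        ≈⟨ sum-cong-≋ (λ k → ·-∑ (h k) (λ l → proj₁ (to eIJ l) · proj₁ x)) ⟨
      ∑ abelianGroup (λ k → h k · coset-∑ ⟦ I ⟧ ⟦ J ⟧ eIJ x)
        ∎)
      where
      eHI = proj₂ (ifin H ⟦ I ⟧ p)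
      eIJ = proj₂ (ifin I ⟦ J ⟧ q)
      eHJ = proj₂ (ifin H ⟦ J ⟧ r)
      module HI = Setoid (⟦ H ⟧ ⧸ ⟦ I ⟧)
      h : Fin (proj₁ (ifin H ⟦ I ⟧ p)) → G.Carrier
      h k = proj₁ (to eHI k)
      I≤H : ⟦ I ⟧ ≤ ⟦ H ⟧
      I≤H = Sub-≤ 𝐢 H {⟦ I ⟧} p
      J≤I : ⟦ J ⟧ ≤ ⟦ I ⟧
      J≤I = Sub-≤ 𝐢 I {⟦ J ⟧} q
      ψ : ∀ k → Setoid.Carrier (⟦ I ⟧ ⧸ ⟦ J ⟧) → Setoid.Carrier (⟦ H ⟧ ⧸ ⟦ J ⟧)
      ψ k (i , i∈I) = h k G.∙ i , ∙-mem ⟦ H ⟧ (proj₂ (to eHI k)) (I≤H i∈I)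
      surj : ∀ y → ∃₂ λ k i → Setoid._≈_ (⟦ H ⟧ ⧸ ⟦ J ⟧) (ψ k i) y
      surj (y , y∈H) = from eHI (y , y∈H) , (_ , strictlyInverseˡ eHI (y , y∈H)) ,
        resp ⟦ J ⟧ (G.trans (G.sym (G.inverseˡ _)) (G.∙-congˡ (\\-leftDividesˡ _ y))) (ε-mem ⟦ J ⟧)
      coset : ∀ k i → ψ k i .proj₁ G.⁻¹ G.∙ h k ∈ˢ ⟦ I ⟧
      coset k (i , i∈I) = resp ⟦ I ⟧
        (G.trans (G.sym (G.identityʳ _)) (G.trans (G.sym (\\-cancel i G.ε (h k))) (G.∙-congˡ (G.identityʳ (h k)))))
        (⁻¹-mem ⟦ I ⟧ i∈I)
      inj₁ : ∀ k i k′ i′ → Setoid._≈_ (⟦ H ⟧ ⧸ ⟦ J ⟧) (ψ k i) (ψ k′ i′) → k ≡ k′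
      inj₁ k i k′ i′ s = ≡.trans (≡.sym (strictlyInverseʳ eHI k)) (≡.trans (from-cong eHI hk≈hk′) (strictlyInverseʳ eHI k′))
        where
        hk≈ψ : to eHI k HI.≈ ψ k i
        hk≈ψ = HI.sym {ψ k i} {to eHI k} (coset k i)
        hk≈hk′ : to eHI k HI.≈ to eHI k′
        hk≈hk′ = HI.trans {to eHI k} {ψ k i} {to eHI k′} hk≈ψ
                   (HI.trans {ψ k i} {ψ k′ i′} {to eHI k′} (J≤I s) (coset k′ i′))

    conjugation : ∀ g H I K L → K ≈ˢ g ▹ H → L ≈ˢ g ▹ I → Inverse (H ⧸ I) (K ⧸ L)
    conjugation g H I K L (K⊆ , ⊆K) (L⊆ , ⊆L) = record
      { to = λ { (x , x∈H) → x ^ᵍ (g G.⁻¹) , ⊆K (resp H (G.sym (^-inverseˡ x g)) x∈H) }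
      ; from = λ { (x , x∈K) → x ^ᵍ g , K⊆ x∈K }
      ; to-cong = λ {x} {y} → to-cong′ {x} {y}
      ; from-cong = λ {x} {y} → from-cong′ {x} {y}
      ; inverse =
          (λ {x} {y} p → ⊆L (resp I (G.sym (G.trans (^-\\ _ (proj₁ x) g) (G.∙-congʳ (G.⁻¹-cong (^-inverseˡ (proj₁ y) g))))) p))
        , (λ {x} {y} p → resp I (G.trans (^-\\ (proj₁ y) _ g) (G.∙-congˡ (^-inverseˡ (proj₁ x) g))) (L⊆ p))
      }
      where
      ^-\\ : ∀ x y g → (x G.⁻¹ G.∙ y) ^ᵍ g G.≈ (x ^ᵍ g) G.⁻¹ G.∙ y ^ᵍ g
      ^-\\ x y g = G.trans (^-∙ (x G.⁻¹) y g) (G.∙-congʳ (^-⁻¹ x g))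
      to-cong′ : ∀ {x y : Σ G.Carrier (_∈ˢ H)} → proj₁ x G.⁻¹ G.∙ proj₁ y ∈ˢ I →
                 (proj₁ x ^ᵍ (g G.⁻¹)) G.⁻¹ G.∙ proj₁ y ^ᵍ (g G.⁻¹) ∈ˢ L
      to-cong′ {x} {y} p = resp L (^-\\ (proj₁ x) (proj₁ y) (g G.⁻¹)) (⊆L (resp I (G.sym (^-inverseˡ _ g)) p))
      from-cong′ : ∀ {x y : Σ G.Carrier (_∈ˢ K)} → proj₁ x G.⁻¹ G.∙ proj₁ y ∈ˢ L →
                   (proj₁ x ^ᵍ g) G.⁻¹ G.∙ proj₁ y ^ᵍ g ∈ˢ I
      from-cong′ {x} {y} p = resp I (^-\\ (proj₁ x) (proj₁ y) g) (L⊆ p)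

    con-ind : ∀ g H I gH gI p q r s x →
              proj₁ (con g H gH p $ (ind H I q $ x)) ≈ proj₁ (ind gH gI r $ (con g I gI s $ x))
    con-ind g H I gH gI p q r s x = sym (begin
      coset-∑ ⟦ gH ⟧ ⟦ gI ⟧ e′ gx
        ≈⟨ ∑-bijection (⟦ gH ⟧ ⧸ ⟦ gI ⟧) (orbit A ⟦ gH ⟧ ⟦ gI ⟧ gx) (λ {h} {h′} → orbit-cong A ⟦ gH ⟧ ⟦ gI ⟧ gx {h} {h′})
             (conjugation g ⟦ H ⟧ ⟦ I ⟧ ⟦ gH ⟧ ⟦ gI ⟧ p s) e′ e ⟩
      ∑ abelianGroup (λ k → (proj₁ (to e k) ^ᵍ (g G.⁻¹)) · g · proj₁ x)
        ≈⟨ sum-cong-≋ (λ k → trans (sym (·-∙ _ g _)) (trans (·-cong (^⁻¹-∙ (proj₁ (to e k)) g) refl) (·-∙ g _ _))) ⟩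
      ∑ abelianGroup (λ k → g · proj₁ (to e k) · proj₁ x)
        ≈⟨ ·-∑ g (λ k → proj₁ (to e k) · proj₁ x) ⟨
      g · coset-∑ ⟦ H ⟧ ⟦ I ⟧ e x ∎)
      where
      gx = con g I gI s $ x
      e = proj₂ (ifin H ⟦ I ⟧ q)
      e′ = proj₂ (ifin gH ⟦ gI ⟧ r)

    mackey : ∀ H I J (I∈ : ⟦ I ⟧ ∈ Sub 𝐫 H) (J∈ : ⟦ J ⟧ ∈ Sub 𝐢 H)
             {n : ℕ} (R : Enumeration n (⟦ I ⟧ ⧹ ⟦ H ⟧ ⧸ ⟦ J ⟧)) x →
             proj₁ (res I H I∈ $ (ind H J J∈ $ x)) ≈
             proj₁ (∑ (A^ I) (λ k → let (h , h∈H) = Inverse.to R k in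
               ind I (∩▹ H I J I∈ J∈ h∈H) (∩▹-𝐢 H I J I∈ J∈ h∈H) $
               (con h (◃∩ H I J I∈ J∈ h∈H) (∩▹ H I J I∈ J∈ h∈H) (▹-∩-◃ ⟦ I ⟧ ⟦ J ⟧ h) $
               (res (◃∩ H I J I∈ J∈ h∈H) J (◃∩-𝐫 H I J I∈ J∈ h∈H) $ x))))
    mackey H I J I∈ J∈ {n} R x = trans partition (trans regroup (sym (hom-∑ {A = A^ I} {abelianGroup} (inclusion A ⟦ I ⟧) {n} _)))
      where
      h : Fin n → G.Carrier
      h k = proj₁ (to R k)
      h∈ : ∀ k → h k ∈ˢ ⟦ H ⟧
      h∈ k = proj₂ (to R k)
      eHJ = proj₂ (ifin H ⟦ J ⟧ J∈)
      IJ : Fin n → 𝔅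
      IJ k = ∩▹ H I J I∈ J∈ (h∈ k)
      fin : ∀ k → Finite (⟦ I ⟧ ⧸ ⟦ IJ k ⟧)
      fin k = ifin I ⟦ IJ k ⟧ (∩▹-𝐢 H I J I∈ J∈ (h∈ k))
      e : ∀ k → Enumeration (proj₁ (fin k)) (⟦ I ⟧ ⧸ ⟦ IJ k ⟧)
      e k = proj₂ (fin k)
      term : Fin n → ∃ (Fixed A ⟦ I ⟧)
      term k = ind I (IJ k) (∩▹-𝐢 H I J I∈ J∈ (h∈ k)) $
               (con (h k) (◃∩ H I J I∈ J∈ (h∈ k)) (IJ k) (▹-∩-◃ ⟦ I ⟧ ⟦ J ⟧ (h k)) $
               (res (◃∩ H I J I∈ J∈ (h∈ k)) J (◃∩-𝐫 H I J I∈ J∈ (h∈ k)) $ x))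
      I≤H : ⟦ I ⟧ ≤ ⟦ H ⟧
      I≤H = Sub-≤ 𝐫 H {⟦ I ⟧} I∈
      ψ : ∀ k → Σ G.Carrier (_∈ˢ ⟦ I ⟧) → Σ G.Carrier (_∈ˢ ⟦ H ⟧)
      ψ k (i , i∈I) = i G.∙ h k , ∙-mem ⟦ H ⟧ (I≤H i∈I) (h∈ k)
      surj : ∀ y → ∃₂ λ k i → Setoid._≈_ (⟦ H ⟧ ⧸ ⟦ J ⟧) (ψ k i) y
      surj y with Setoid.sym (⟦ I ⟧ ⧹ ⟦ H ⟧ ⧸ ⟦ J ⟧) {to R (from R y)} {y} (strictlyInverseˡ R y)
      ... | i , j , i∈I , j∈J , y≈ihj = from R y , (i , i∈I) ,
        resp ⟦ J ⟧ (G.sym (G.trans (G.∙-congˡ y≈ihj) (\\-leftDividesʳ _ j))) j∈J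
      inj₁ : ∀ k i k′ i′ → Setoid._≈_ (⟦ H ⟧ ⧸ ⟦ J ⟧) (ψ k i) (ψ k′ i′) → k ≡ k′
      inj₁ k (i , i∈I) k′ (i′ , i′∈I) s = ≡.trans (≡.sym (strictlyInverseʳ R k))
        (≡.trans (from-cong R (DC.sym {to R k′} {to R k} hk′≈hk)) (strictlyInverseʳ R k′))
        where
        module DC = Setoid (⟦ I ⟧ ⧹ ⟦ H ⟧ ⧸ ⟦ J ⟧)
        hk′≈hk : to R k′ DC.≈ to R k
        hk′≈hk = i′ G.⁻¹ G.∙ i , (i G.∙ h k) G.⁻¹ G.∙ (i′ G.∙ h k′)
          , ∙-mem ⟦ I ⟧ (⁻¹-mem ⟦ I ⟧ i′∈I) i∈I , s
          , G.sym (G.trans (G.∙-congʳ (G.assoc _ _ _)) (G.trans (G.assoc _ _ _)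
              (G.trans (G.∙-congˡ (\\-leftDividesˡ _ _)) (\\-leftDividesʳ i′ (h k′)))))

      partition : coset-∑ ⟦ H ⟧ ⟦ J ⟧ eHJ x ≈
                  ∑ abelianGroup (λ k → ∑ abelianGroup (λ l → (proj₁ (to (e k) l) G.∙ h k) · proj₁ x))
      partition = ∑-fibres (⟦ H ⟧ ⧸ ⟦ J ⟧) (orbit A ⟦ H ⟧ ⟦ J ⟧ x) (λ {h} {h′} → orbit-cong A ⟦ H ⟧ ⟦ J ⟧ x {h} {h′}) eHJ {n} {λ k → proj₁ (fin k)} {λ k → ⟦ I ⟧ ⧸ ⟦ IJ k ⟧} e ψ
        (λ k {y} {z} p → resp ⟦ J ⟧ (G.sym (\\-translate (proj₁ y) (proj₁ z) (h k))) (proj₂ p))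
        surj
        (λ {k} {l} {k′} {l′} s → inj₁ k (to (e k) l) k′ (to (e k′) l′) s)
        (λ {k} {y} {z} p → ∙-mem ⟦ I ⟧ (⁻¹-mem ⟦ I ⟧ (proj₂ y)) (proj₂ z)
                         , resp ⟦ J ⟧ (\\-translate (proj₁ y) (proj₁ z) (h k)) p)
      regroup : ∑ abelianGroup (λ k → ∑ abelianGroup (λ l → (proj₁ (to (e k) l) G.∙ h k) · proj₁ x)) ≈
                ∑ abelianGroup (λ k → proj₁ (term k))
      regroup = sum-cong-≋ {n} (λ k → sum-cong-≋ {proj₁ (fin k)} (λ l → ·-∙ (proj₁ (to (e k) l)) (h k) (proj₁ x)))

  functor : MackeyFunctor 𝔐 a
  functor = record
    { Φ = A^_ ; res = res ; ind = ind ; con = con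
    ; res-id = λ H p x → refl
    ; ind-id = ind-id
    ; con-id = λ h H p h∈H x → proj₂ x h∈H
    ; res-res = λ J I H p q r x → refl
    ; ind-ind = ind-ind
    ; con-con = λ g′ g H K L p q r x → sym (·-∙ g′ g (proj₁ x))
    ; con-≈ = λ g g′ H K p q g≈g′ x → ·-cong g≈g′ refl
    ; con-res = λ g I H gI gH p q r s x → refl
    ; con-ind = con-ind
    ; mackey = mackey
    }

module _ {ℓ : Level} (G : TopologicalGroup ℓ)
  (𝔐 : MackeySystem (TopologicalGroup.group G)) (ifin : IFinite (MackeySystem.system 𝔐)) (a : Level) where
  private module G = TopologicalGroup G
  open MackeySystem 𝔐
  open ModuleMorphism

  -- A ↦ A_*
  invariants⁎ : Functor (GAbᵈ G a) (Mack 𝔐 a)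
  invariants⁎ = record
    { F₀ = Invariants.functor {G = G} 𝔐 ifin {a}
    ; F₁ = λ {A} {B} → restrict {A} {B}
    ; F-resp-≈ = λ f≈g H x → f≈g (proj₁ x)
    ; F-id = λ {A} H x → DiscreteModule.refl A
    ; F-∘ = λ {_} {_} {C} f g H x → DiscreteModule.refl C
    }
    where
    restrict : ∀ {A B} → ModuleMorphism G a A B →
               MackeyMorphism 𝔐 a (Invariants.functor {G = G} 𝔐 ifin {a} A) (Invariants.functor {G = G} 𝔐 ifin {a} B)
    restrict {A} {B} f = record
      { φ = λ H → mkHom (invariants A ⟦ H ⟧) (invariants B ⟦ H ⟧)
          (λ { (x , p) → hom f $ x , λ {h} h∈H → B.trans (B.sym (equivariant f h x)) (f.⟦⟧-cong (p h∈H)) })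
          f.⟦⟧-cong (λ x y → f.homo (proj₁ x) (proj₁ y))
      ; φ-res = λ I H p x → B.refl
      ; φ-ind = λ H I p x → B.trans
          (hom-∑ {A = A.abelianGroup} {B.abelianGroup} (hom f) (λ k → rep H I p k A.· proj₁ x))
          (Summation.sum-cong-≋ B.commutativeMonoid {proj₁ (ifin H ⟦ I ⟧ p)} (λ k → equivariant f (rep H I p k) (proj₁ x)))
      ; φ-con = λ g H K p x → equivariant f g (proj₁ x)
      }
      where
      module A = DiscreteModule A
      module B = DiscreteModule B
      module f = GroupHomomorphism (hom f)
      rep : ∀ H I (p : ⟦ I ⟧ ∈ Sub 𝐢 H) → Fin (proj₁ (ifin H ⟦ I ⟧ p)) → G.Carrier
      rep H I p k = proj₁ (Inverse.to (proj₂ (ifin H ⟦ I ⟧ p)) k)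

module Colimit {ℓ : Level} {G : TopologicalGroup ℓ} {𝔐 : MackeySystem (TopologicalGroup.group G)}
  (𝒟 : DescentBasis G 𝔐) {a : Level} (F : MackeyFunctor 𝔐 a) where
  private module G = TopologicalGroup G
  open Subgroups G.group
  open MackeySystem 𝔐
  open DescentBasis 𝒟
  open MackeyFunctor F
  open GroupHomomorphism using (⟦⟧-cong; homo; ε-homo; ⁻¹-homo)
  private module Φ U = AbelianGroup (Φ U)

  Index : Set (lsuc ℓ)
  Index = ∃ 𝒰

  infix 4 _≼_

  _≼_ : Index → Index → Set ℓ
  V ≼ U = ⟦ proj₁ V ⟧ ≤ ⟦ proj₁ U ⟧

  ⟪_⟫ : Index → Set (lsuc ℓ ⊔ a)
  ⟪ U ⟫ = Φ.Carrier (proj₁ U)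

  ρ : ∀ U V → V ≼ U → Φ (proj₁ U) ⟶ Φ (proj₁ V)
  ρ (U , _) (V , V∈) V≤U = res V U (𝒰⊆𝐫 U V V∈ V≤U)

  ρ-ρ : ∀ U V W (p : V ≼ U) (q : W ≼ V) (r : W ≼ U) x → ρ V W q $ (ρ U V p $ x) ≈ ρ U W r $ x
  ρ-ρ U V W p q r x = res-res (proj₁ W) (proj₁ V) (proj₁ U) _ _ _ x

  meet : ∀ U V → ∃ λ W → W ≼ U × W ≼ V
  meet (U , U∈) (V , V∈) with directed U V U∈ V∈
  ... | W , W∈ , W≤ = (W , W∈) , (λ p → proj₁ (W≤ p)) , (λ p → proj₂ (W≤ p))

  -- A pair (U , x) stands for the class of x ∈ Φ(U).
  Germ : Set (lsuc ℓ ⊔ a)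
  Germ = Σ Index ⟪_⟫

  infix 4 _∼_

  _∼_ : Rel Germ (lsuc ℓ ⊔ a)
  (U , x) ∼ (V , y) = ∃ λ W → Σ (W ≼ U) λ p → Σ (W ≼ V) λ q → ρ U W p $ x ≈ ρ V W q $ y

  ∼-reflexive : ∀ U {x y : ⟪ U ⟫} → x ≈ y → (U , x) ∼ (U , y)
  ∼-reflexive U p = U , (λ q → q) , (λ q → q) , ⟦⟧-cong (ρ U U (λ q → q)) p

  ∼-sym : ∀ {s t} → s ∼ t → t ∼ s
  ∼-sym (W , p , q , e) = W , q , p , Φ.sym (proj₁ W) e

  shrink : ∀ U V W W′ {x : ⟪ U ⟫} {y : ⟪ V ⟫} (p : W ≼ U) (q : W ≼ V) (r : W′ ≼ W) (p′ : W′ ≼ U) (q′ : W′ ≼ V) →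
           ρ U W p $ x ≈ ρ V W q $ y → ρ U W′ p′ $ x ≈ ρ V W′ q′ $ y
  shrink U V W W′ {x} {y} p q r p′ q′ e = Φ.trans (proj₁ W′)
    (Φ.sym (proj₁ W′) (ρ-ρ U W W′ p r p′ x))
    (Φ.trans (proj₁ W′) (⟦⟧-cong (ρ W W′ r) e) (ρ-ρ V W W′ q r q′ y))

  ∼-trans : ∀ {s t u} → s ∼ t → t ∼ u → s ∼ u
  ∼-trans {U₁ , x} {U₂ , y} {U₃ , z} (W , p , q , e) (W′ , p′ , q′ , e′) with meet W W′
  ... | X , X≤W , X≤W′ = X , (λ m → p (X≤W m)) , (λ m → q′ (X≤W′ m)) , Φ.trans (proj₁ X)
    (shrink U₁ U₂ W X p q X≤W (λ m → p (X≤W m)) (λ m → q (X≤W m)) e)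
    (shrink U₂ U₃ W′ X p′ q′ X≤W′ (λ m → q (X≤W m)) (λ m → q′ (X≤W′ m)) e′)

  infixl 6 _⊕_

  _⊕_ : Germ → Germ → Germ
  (U , x) ⊕ (V , y) = let (W , W≤U , W≤V) = meet U V in
    W , Φ._∙_ (proj₁ W) (ρ U W W≤U $ x) (ρ V W W≤V $ y)

  𝟘 : Germ
  𝟘 = nonempty , Φ.ε (proj₁ nonempty)

  ⊖_ : Germ → Germ
  ⊖ (U , x) = U , Φ._⁻¹ (proj₁ U) x

  ρ-⊕ : ∀ s t W → let U = proj₁ s ; V = proj₁ t in
        (p : W ≼ proj₁ (s ⊕ t)) (q : W ≼ U) (r : W ≼ V) →
        ρ (proj₁ (s ⊕ t)) W p $ proj₂ (s ⊕ t) ≈ Φ._∙_ (proj₁ W) (ρ U W q $ proj₂ s) (ρ V W r $ proj₂ t)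
  ρ-⊕ (U , x) (V , y) W p q r = let (X , X≤U , X≤V) = meet U V in Φ.trans (proj₁ W)
    (homo (ρ X W p) _ _)
    (Φ.∙-cong (proj₁ W) (ρ-ρ U X W X≤U p q x) (ρ-ρ V X W X≤V p r y))

  private
    ≼₁ : ∀ s t → proj₁ (s ⊕ t) ≼ proj₁ s
    ≼₁ s t = proj₁ (proj₂ (meet (proj₁ s) (proj₁ t)))

    ≼₂ : ∀ s t → proj₁ (s ⊕ t) ≼ proj₁ t
    ≼₂ s t = proj₂ (proj₂ (meet (proj₁ s) (proj₁ t)))

    ⊕-cong : ∀ {s s′ t t′} → s ∼ s′ → t ∼ t′ → s ⊕ t ∼ s′ ⊕ t′
    ⊕-cong {s} {s′} {t} {t′} (W , p , p′ , e) (W′ , q , q′ , e′) =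
      let (X , X≤W , X≤W′) = meet W W′
          (Y , Y≤⊕ , Y≤⊕′) = meet (proj₁ (s ⊕ t)) (proj₁ (s′ ⊕ t′))
          (Z , Z≤X , Z≤Y)  = meet X Y
          z = proj₁ Z
      in Z , (λ m → Y≤⊕ (Z≤Y m)) , (λ m → Y≤⊕′ (Z≤Y m)) ,
      Φ.trans z (ρ-⊕ s t Z (λ m → Y≤⊕ (Z≤Y m)) (λ m → p (X≤W (Z≤X m))) (λ m → q (X≤W′ (Z≤X m))))
      (Φ.trans z (Φ.∙-cong z
         (shrink (proj₁ s) (proj₁ s′) W Z p p′ (λ m → X≤W (Z≤X m)) (λ m → p (X≤W (Z≤X m))) (λ m → p′ (X≤W (Z≤X m))) e)
         (shrink (proj₁ t) (proj₁ t′) W′ Z q q′ (λ m → X≤W′ (Z≤X m)) (λ m → q (X≤W′ (Z≤X m))) (λ m → q′ (X≤W′ (Z≤X m))) e′))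
      (Φ.sym z (ρ-⊕ s′ t′ Z (λ m → Y≤⊕′ (Z≤Y m)) (λ m → p′ (X≤W (Z≤X m))) (λ m → q′ (X≤W′ (Z≤X m))))))

    ⊕-assoc : ∀ s t u → (s ⊕ t) ⊕ u ∼ s ⊕ (t ⊕ u)
    ⊕-assoc s t u =
      let (Z , Z≤l , Z≤r) = meet (proj₁ ((s ⊕ t) ⊕ u)) (proj₁ (s ⊕ (t ⊕ u)))
          z = proj₁ Z
          Z≤st : Z ≼ proj₁ (s ⊕ t)
          Z≤st = λ m → ≼₁ (s ⊕ t) u (Z≤l m)
          Z≤u : Z ≼ proj₁ u
          Z≤u = λ m → ≼₂ (s ⊕ t) u (Z≤l m)
          Z≤s : Z ≼ proj₁ s
          Z≤s = λ m → ≼₁ s t (Z≤st m)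
          Z≤t : Z ≼ proj₁ t
          Z≤t = λ m → ≼₂ s t (Z≤st m)
          Z≤tu : Z ≼ proj₁ (t ⊕ u)
          Z≤tu = λ m → ≼₂ s (t ⊕ u) (Z≤r m)
      in Z , Z≤l , Z≤r ,
      Φ.trans z (ρ-⊕ (s ⊕ t) u Z Z≤l Z≤st Z≤u)
      (Φ.trans z (Φ.∙-congʳ z (ρ-⊕ s t Z Z≤st Z≤s Z≤t))
      (Φ.trans z (Φ.assoc z _ _ _)
      (Φ.trans z (Φ.∙-congˡ z (Φ.sym z (ρ-⊕ t u Z Z≤tu Z≤t Z≤u)))
      (Φ.sym z (ρ-⊕ s (t ⊕ u) Z Z≤r Z≤s Z≤tu)))))

    ⊕-comm : ∀ s t → s ⊕ t ∼ t ⊕ s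
    ⊕-comm s t =
      let (Z , Z≤l , Z≤r) = meet (proj₁ (s ⊕ t)) (proj₁ (t ⊕ s))
          z = proj₁ Z
          Z≤s : Z ≼ proj₁ s
          Z≤s = λ m → ≼₁ s t (Z≤l m)
          Z≤t : Z ≼ proj₁ t
          Z≤t = λ m → ≼₂ s t (Z≤l m)
      in Z , Z≤l , Z≤r ,
      Φ.trans z (ρ-⊕ s t Z Z≤l Z≤s Z≤t)
      (Φ.trans z (Φ.comm z _ _) (Φ.sym z (ρ-⊕ t s Z Z≤r Z≤t Z≤s)))

    ⊕-identityˡ : ∀ s → 𝟘 ⊕ s ∼ s
    ⊕-identityˡ s =
      let Z = proj₁ (𝟘 ⊕ s)
          z = proj₁ Z
      in Z , (λ m → m) , ≼₂ 𝟘 s ,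
      Φ.trans z (ρ-⊕ 𝟘 s Z (λ m → m) (≼₁ 𝟘 s) (≼₂ 𝟘 s))
      (Φ.trans z (Φ.∙-congʳ z (ε-homo (ρ (proj₁ 𝟘) Z (≼₁ 𝟘 s)))) (Φ.identityˡ z _))

    ⊕-inverseˡ : ∀ s → (⊖ s) ⊕ s ∼ 𝟘
    ⊕-inverseˡ s =
      let (Z , Z≤l , Z≤0) = meet (proj₁ ((⊖ s) ⊕ s)) (proj₁ 𝟘)
          z = proj₁ Z
          Z≤s : Z ≼ proj₁ s
          Z≤s = λ m → ≼₂ (⊖ s) s (Z≤l m)
      in Z , Z≤l , Z≤0 ,
      Φ.trans z (ρ-⊕ (⊖ s) s Z Z≤l Z≤s Z≤s)
      (Φ.trans z (Φ.∙-congʳ z (⁻¹-homo (ρ (proj₁ s) Z Z≤s) (proj₂ s)))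
      (Φ.trans z (Φ.inverseˡ z _) (Φ.sym z (ε-homo (ρ (proj₁ 𝟘) Z Z≤0)))))

    ⊖-cong : ∀ {s t} → s ∼ t → ⊖ s ∼ ⊖ t
    ⊖-cong {U , x} {V , y} (W , p , q , e) = W , p , q , Φ.trans (proj₁ W) (⁻¹-homo (ρ U W p) x)
      (Φ.trans (proj₁ W) (Φ.⁻¹-cong (proj₁ W) e) (Φ.sym (proj₁ W) (⁻¹-homo (ρ V W q) y)))

  colimit : Ab ℓ a
  colimit = record
    { Carrier = Germ ; _≈_ = _∼_ ; _∙_ = _⊕_ ; ε = 𝟘 ; _⁻¹ = ⊖_
    ; isAbelianGroup = record
      { isGroup = record
        { isMonoid = record
          { isSemigroup = record
            { isMagma = record
              { isEquivalence = record
                { refl = λ {s} → ∼-reflexive (proj₁ s) (Φ.refl (proj₁ (proj₁ s)))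
                ; sym = λ {s} {t} → ∼-sym {s} {t}
                ; trans = λ {s} {t} {u} → ∼-trans {s} {t} {u}
                }
              ; ∙-cong = λ {s} {s′} {t} {t′} → ⊕-cong {s} {s′} {t} {t′}
              }
            ; assoc = ⊕-assoc
            }
          ; identity = ⊕-identityˡ
                     , λ s → ∼-trans {s ⊕ 𝟘} {𝟘 ⊕ s} {s} (⊕-comm s 𝟘) (⊕-identityˡ s)
          }
        ; inverse = ⊕-inverseˡ
                  , λ s → ∼-trans {s ⊕ (⊖ s)} {(⊖ s) ⊕ s} {𝟘} (⊕-comm s (⊖ s)) (⊕-inverseˡ s)
        ; ⁻¹-cong = λ {s} {t} → ⊖-cong {s} {t}
        }
      ; comm = ⊕-comm
      }
    }

  con𝒰 : ∀ g U → Φ (proj₁ U) ⟶ Φ (proj₁ U)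
  con𝒰 g (U , U∈) = con g U U (normal-𝒰 U U∈ g)

  infixr 8 _⊙_

  _⊙_ : G.Carrier → Germ → Germ
  g ⊙ (U , x) = U , con𝒰 g U $ x

  ρ-con : ∀ g U V (p : V ≼ U) x → ρ U V p $ (con𝒰 g U $ x) ≈ con𝒰 g V $ (ρ U V p $ x)
  ρ-con g U V p x = Φ.sym (proj₁ V) (con-res g (proj₁ V) (proj₁ U) (proj₁ V) (proj₁ U) _ _ _ _ x)

  con𝒰-≈ : ∀ {g h} U → g G.≈ h → ∀ x → con𝒰 g U $ x ≈ con𝒰 h U $ x
  con𝒰-≈ U g≈h x = con-≈ _ _ (proj₁ U) (proj₁ U) _ _ g≈h x

  con𝒰-∙ : ∀ g h U x → con𝒰 (g G.∙ h) U $ x ≈ con𝒰 g U $ (con𝒰 h U $ x)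
  con𝒰-∙ g h U x = Φ.sym (proj₁ U) (con-con g h (proj₁ U) (proj₁ U) (proj₁ U) _ _ _ x)

  private
    ⊙-cong : ∀ {g h s t} → g G.≈ h → s ∼ t → g ⊙ s ∼ h ⊙ t
    ⊙-cong {g} {h} {U , x} {V , y} g≈h (W , p , q , e) = W , p , q ,
      Φ.trans (proj₁ W) (ρ-con g U W p x)
      (Φ.trans (proj₁ W) (⟦⟧-cong (con𝒰 g W) e)
      (Φ.trans (proj₁ W) (con𝒰-≈ W g≈h _)
      (Φ.sym (proj₁ W) (ρ-con h V W q y))))

    ⊙-⊕ : ∀ g s t → g ⊙ (s ⊕ t) ∼ (g ⊙ s) ⊕ (g ⊙ t)
    ⊙-⊕ g s t =
      let Z = proj₁ (s ⊕ t) ; z = proj₁ Z in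
      ∼-reflexive Z (Φ.trans z (homo (con𝒰 g Z) _ _) (Φ.∙-cong z
        (Φ.sym z (ρ-con g (proj₁ s) Z (≼₁ s t) (proj₂ s)))
        (Φ.sym z (ρ-con g (proj₁ t) Z (≼₂ s t) (proj₂ t)))))

    ⊙-continuous : ∀ g s → ∃ λ V → G.IsOpen V × g ∈ V × (∀ {v} → v ∈ V → v ⊙ s ∼ g ⊙ s)
    ⊙-continuous g ((U , U∈) , x) =
      let (_ , W , _ , W-open , g⁻¹∈ , g∈W , mul) =
            G.∙-continuous (open-𝒰 U U∈) (g G.⁻¹) g 
              (Subgroup.resp ⟦ U ⟧ (G.sym (G.inverseˡ g)) (Subgroup.ε-mem ⟦ U ⟧))
      in W , W-open , g∈W , λ {v} v∈W → ∼-reflexive (U , U∈)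
           (Φ.trans U (con𝒰-≈ (U , U∈) (G.sym (GroupProperties.\\-leftDividesˡ G.group g v)) x)
           (Φ.trans U (con𝒰-∙ g (g G.⁻¹ G.∙ v) (U , U∈) x)
           (⟦⟧-cong (con𝒰 g (U , U∈)) (con-id _ U _ (mul g⁻¹∈ v∈W) x))))

  discreteModule : DiscreteModule G a
  discreteModule = record
    { abelianGroup = colimit
    ; _·_ = _⊙_
    ; ·-cong = λ {g} {h} {s} {t} → ⊙-cong {g} {h} {s} {t}
    ; ·-+ = ⊙-⊕
    ; ·-ε = λ { ((U , U∈) , x) → ∼-reflexive (U , U∈) (con-id G.ε U _ (Subgroup.ε-mem ⟦ U ⟧) x) }
    ; ·-∙ = λ { g h (U , x) → ∼-reflexive U (con𝒰-∙ g h U x) }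
    ; ·-continuous = ⊙-continuous
    }

module _ {ℓ : Level} {G : TopologicalGroup ℓ} {𝔐 : MackeySystem (TopologicalGroup.group G)}
  (𝒟 : DescentBasis G 𝔐) (a : Level) where
  open MackeySystem 𝔐
  open DescentBasis 𝒟
  open MackeyMorphism
  private
    module M = MackeyFunctor
    module C (F : MackeyFunctor 𝔐 a) = Colimit 𝒟 F

  -- Φ ↦ Φ^*_𝒰
  colim* : Functor (Mack 𝔐 a) (GAbᵈ G a)
  colim* = record
    { F₀ = Colimit.discreteModule 𝒟
    ; F₁ = induced
    ; F-resp-≈ = λ {_} {F′} f≈g s → C.∼-reflexive F′ (proj₁ s) (f≈g (proj₁ (proj₁ s)) (proj₂ s))
    ; F-id = λ {F} s → C.∼-reflexive F (proj₁ s) (AbelianGroup.refl (M.Φ F (proj₁ (proj₁ s))))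
    ; F-∘ = λ {_} {_} {F″} f g s → C.∼-reflexive F″ (proj₁ s) (AbelianGroup.refl (M.Φ F″ (proj₁ (proj₁ s))))
    }
    where
    induced : ∀ {F F′} → MackeyMorphism 𝔐 a F F′ →
              ModuleMorphism G a (Colimit.discreteModule 𝒟 F) (Colimit.discreteModule 𝒟 F′)
    induced {F} {F′} f = record
      { hom = mkHom F.colimit F′.colimit
          (λ { (U , x) → U , φ f (proj₁ U) $ x })
          (λ { {U , x} {V , y} ((W , W∈) , p , q , e) → (W , W∈) , p , q ,
            Φ′.trans W (Φ′.sym W (φ-res f W (proj₁ U) _ x))
            (Φ′.trans W (f.⟦⟧-cong W e) (φ-res f W (proj₁ V) _ y)) })
          (λ s t → F′.∼-reflexive (proj₁ (s F.⊕ t))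
            (Φ′.trans _ (f.homo _ _ _) (Φ′.∙-cong _ (φ-res f _ _ _ _) (φ-res f _ _ _ _))))
      ; equivariant = λ { g ((U , U∈) , x) → F′.∼-reflexive (U , U∈) (φ-con f g U U _ x) }
      }
      where
      module F = Colimit 𝒟 F
      module F′ = Colimit 𝒟 F′
      module Φ′ U = AbelianGroup (M.Φ F′ U)
      module f U = GroupHomomorphism (φ f U)

{-# OPTIONS --safe #-}

-- The unit sends x ∈ Φ(H) to the class of res_{U,H}(x) for any U ∈ 𝒰(H).  Its
-- compatibility with induction is the only non-formal point: if U ∈ 𝒰 lies in I
-- then U is normal, so U∖H/I = H/I and U ∩ ʰI = U, and the Mackey formula
-- becomes res_{U,H} ind_{H,I} = ∑_{h ∈ H/I} con_{h,U} res_{U,I}.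

module Submission where

open import Level using (Level)
open import Algebra.Bundles using (AbelianGroup)
open import Algebra.Morphism.Bundles using (GroupHomomorphism)
import Algebra.Properties.CommutativeMonoid.Sum as Summation
import Algebra.Properties.Group as GroupProperties
open import Data.Fin.Base using (Fin)
open import Data.Nat.Base using (ℕ)
open import Data.Product.Base using (_,_; proj₁; proj₂)
open import Function.Bundles using (Inverse)
open import Function.Construct.Composition using () renaming (inverse to _∘ⁱ_)
open import Relation.Binary.Bundles using (Setoid)
import Relation.Binary.Reasoning.Setoid as SetoidReasoning
open import Relation.Unary using (_∈_)
open import Defs

open GroupHomomorphism using (⟦⟧-cong; homo) renaming (⟦_⟧ to infixl 20 _$_)

-- Double cosets of a normal subgroup.

module _ {ℓ a : Level} (G : TopologicalGroup ℓ) (𝔐 : MackeySystem (TopologicalGroup.group G)) where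
  private module G = TopologicalGroup G
  open Subgroups G.group
  open Subgroup
  open MackeySystem 𝔐

  -- A factor `u` on the left of `y` moves to the right as the conjugate of `u` by `y`, which stays
  -- in `U` by normality and is then absorbed by `I`. The bijection is the identity on elements, so
  -- representatives are kept.
  normal-⧹⧸ : ∀ U H I → Normal U → U ≤ I → Inverse (H ⧸ I) (U ⧹ H ⧸ I)
  normal-⧹⧸ U H I normal U≤I = record
    { to = λ x → x
    ; from = λ x → x
    ; to-cong = λ {x} {y} → right {x} {y}
    ; from-cong = λ {x} {y} → left {x} {y}
    ; inverse = (λ {x} {y} → right {y} {x}) , (λ {x} {y} → left {y} {x})
    }
    where
    open GroupProperties G.group using (\\-leftDividesˡ)
    open SetoidReasoning G.setoid
    right : ∀ {x y} → Setoid._≈_ (H ⧸ I) x y → Setoid._≈_ (U ⧹ H ⧸ I) x y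
    right {x , x∈} {y , y∈} p = G.ε , y G.⁻¹ G.∙ x , ε-mem U , Setoid.sym (H ⧸ I) {x , x∈} {y , y∈} p , (begin
      x                                 ≈⟨ \\-leftDividesˡ y x ⟨
      y G.∙ (y G.⁻¹ G.∙ x)              ≈⟨ G.∙-congʳ (G.identityˡ y) ⟨
      G.ε G.∙ y G.∙ (y G.⁻¹ G.∙ x)      ∎)
    left : ∀ {x y} → Setoid._≈_ (U ⧹ H ⧸ I) x y → Setoid._≈_ (H ⧸ I) x y
    left {x , x∈} {y , y∈} (u , j , u∈U , j∈I , p) =
      Setoid.sym (H ⧸ I) {y , y∈} {x , x∈} (resp I
        (begin
          y G.⁻¹ G.∙ u G.∙ y G.∙ j       ≈⟨ G.∙-congʳ (G.assoc _ _ _) ⟩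
          y G.⁻¹ G.∙ (u G.∙ y) G.∙ j     ≈⟨ G.assoc _ _ _ ⟩
          y G.⁻¹ G.∙ (u G.∙ y G.∙ j)     ≈⟨ G.∙-congˡ p ⟨
          y G.⁻¹ G.∙ x                   ∎)
        (∙-mem I (U≤I (proj₁ (normal y) u∈U)) j∈I))

  -- Equal subgroups, and induction followed by restriction to a normal subgroup.

  module Identifications (F : MackeyFunctor 𝔐 a) where
    open MackeyFunctor F
    private module Φ H = AbelianGroup (Φ H)

    ≈-ε▹ : ∀ {H K} → K ≈ˢ H → K ≈ˢ G.ε ▹ H
    ≈-ε▹ {H} (K≤H , H≤K) =
        (λ {x} x∈K → resp H (G.sym (^-identity x)) (K≤H x∈K))
      , (λ {x} x∈H → H≤K (resp H (^-identity x) x∈H))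
      where open Conjugation G.group using (^-identity)

    transport : ∀ H K → ⟦ K ⟧ ≈ˢ ⟦ H ⟧ → Φ H ⟶ Φ K
    transport H K K≈H = con G.ε H K (≈-ε▹ {⟦ H ⟧} {⟦ K ⟧} K≈H)

    ≈ˢ-refl : ∀ {H} → H ≈ˢ H
    ≈ˢ-refl = (λ p → p) , (λ p → p)

    -- `ind-id` covers only an induction from `H` itself. Conjugation by `ε` is trivial on `Φ H`,
    -- and `con-ind` carries it through the induction, where it replaces `K` by `H`.
    ind-≈ : ∀ H K K∈ (H≈K : ⟦ H ⟧ ≈ˢ ⟦ K ⟧) x → ind H K K∈ $ x ≈ transport K H H≈K $ x
    ind-≈ H K K∈ H≈K x = begin
      ind H K K∈ $ x
        ≈⟨ con-id G.ε H (≈-ε▹ {⟦ H ⟧} {⟦ H ⟧} (≈ˢ-refl {⟦ H ⟧})) (ε-mem ⟦ H ⟧) _ ⟨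
      con G.ε H H (≈-ε▹ {⟦ H ⟧} {⟦ H ⟧} (≈ˢ-refl {⟦ H ⟧})) $ (ind H K K∈ $ x)
        ≈⟨ con-ind G.ε H K H H _ K∈ (Sub-refl 𝐢 H) _ x ⟩
      ind H H (Sub-refl 𝐢 H) $ (transport K H H≈K $ x)
        ≈⟨ ind-id H _ _ ⟩
      transport K H H≈K $ x ∎
      where open SetoidReasoning (Φ.setoid H)

    res-≈ : ∀ H I K I∈ K∈ (K≈I : ⟦ K ⟧ ≈ˢ ⟦ I ⟧) x →
            res K H K∈ $ x ≈ transport I K K≈I $ (res I H I∈ $ x)
    res-≈ H I K I∈ K∈ K≈I x = begin
      res K H K∈ $ x
        ≈⟨ ⟦⟧-cong (res K H K∈) (con-id G.ε H (≈-ε▹ {⟦ H ⟧} {⟦ H ⟧} (≈ˢ-refl {⟦ H ⟧})) (ε-mem ⟦ H ⟧) x) ⟨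
      res K H K∈ $ (con G.ε H H (≈-ε▹ {⟦ H ⟧} {⟦ H ⟧} (≈ˢ-refl {⟦ H ⟧})) $ x)
        ≈⟨ con-res G.ε I H K H _ I∈ K∈ _ x ⟨
      transport I K K≈I $ (res I H I∈ $ x) ∎
      where open SetoidReasoning (Φ.setoid K)

    res-ind-normal : ∀ H I U (I∈ : ⟦ I ⟧ ∈ Sub 𝐢 H) (U∈I : ⟦ U ⟧ ∈ Sub 𝐫 I) (U∈H : ⟦ U ⟧ ∈ Sub 𝐫 H)
                     (normal : Normal ⟦ U ⟧) {n : ℕ} (e : Enumeration n (⟦ H ⟧ ⧸ ⟦ I ⟧)) x →
                     res U H U∈H $ (ind H I I∈ $ x) ≈
                     ∑ (Φ U) (λ k → let h = proj₁ (Inverse.to e k) in con h U U (normal h) $ (res U I U∈I $ x))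
    res-ind-normal H I U I∈ U∈I U∈H normal {n} e x = Φ.trans U
      -- An enumeration of the left cosets also enumerates the double cosets, with the same
      -- representatives, so the two sums can be compared term by term.
      (mackey H U I U∈H I∈ (e ∘ⁱ normal-⧹⧸ ⟦ U ⟧ ⟦ H ⟧ ⟦ I ⟧ normal U≤I) x)
      (Summation.sum-cong-≋ (Φ.commutativeMonoid U) {n} (λ k → term (proj₁ (Inverse.to e k)) (proj₂ (Inverse.to e k))))
      where
      U≤I : ⟦ U ⟧ ≤ ⟦ I ⟧
      U≤I = Sub-≤ 𝐫 I {⟦ U ⟧} U∈I
      open SetoidReasoning (Φ.setoid U)
      term : ∀ h (h∈H : h ∈ˢ ⟦ H ⟧) →
             ind U (∩▹ H U I U∈H I∈ h∈H) (∩▹-𝐢 H U I U∈H I∈ h∈H) $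
             (con h (◃∩ H U I U∈H I∈ h∈H) (∩▹ H U I U∈H I∈ h∈H) (▹-∩-◃ ⟦ U ⟧ ⟦ I ⟧ h) $
             (res (◃∩ H U I U∈H I∈ h∈H) I (◃∩-𝐫 H U I U∈H I∈ h∈H) $ x)) ≈
             con h U U (normal h) $ (res U I U∈I $ x)
      -- Induction and restriction between equal subgroups become conjugations by `ε`. `con-con`
      -- then merges these with the conjugation by `h`, and `con-≈` removes the units from the
      -- product.
      term h h∈H = begin
        ind U K _ $ (con h L K L→K $ (res L I _ $ x))
          ≈⟨ ind-≈ U K _ U≈K _ ⟩
        transport K U U≈K $ (con h L K L→K $ (res L I _ $ x))
          ≈⟨ con-con G.ε h L K U _ L→K L→U _ ⟩
        con (G.ε G.∙ h) L U L→U $ (res L I _ $ x)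
          ≈⟨ ⟦⟧-cong (con (G.ε G.∙ h) L U L→U) (res-≈ I U L U∈I _ L≈U x) ⟩
        con (G.ε G.∙ h) L U L→U $ (transport U L L≈U $ (res U I U∈I $ x))
          ≈⟨ con-con (G.ε G.∙ h) G.ε U L U L→U _ (normal (G.ε G.∙ h G.∙ G.ε)) _ ⟩
        con (G.ε G.∙ h G.∙ G.ε) U U (normal (G.ε G.∙ h G.∙ G.ε)) $ (res U I U∈I $ x)
          ≈⟨ con-≈ _ h U U _ (normal h) (G.trans (G.identityʳ _) (G.identityˡ h)) _ ⟩
        con h U U (normal h) $ (res U I U∈I $ x) ∎
        where
        K = ∩▹ H U I U∈H I∈ h∈H
        L = ◃∩ H U I U∈H I∈ h∈H
        L→K = ▹-∩-◃ ⟦ U ⟧ ⟦ I ⟧ h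
        U≈K : ⟦ U ⟧ ≈ˢ ⟦ K ⟧
        U≈K = (λ u∈ → u∈ , U≤I (proj₁ (normal h) u∈)) , proj₁
        L≈U : ⟦ L ⟧ ≈ˢ ⟦ U ⟧
        L≈U = (λ p → proj₂ (normal (h G.⁻¹)) (proj₁ p)) , (λ u∈ → proj₁ (normal (h G.⁻¹)) u∈ , U≤I u∈)
        L→U : ⟦ U ⟧ ≈ˢ (G.ε G.∙ h) ▹ ⟦ L ⟧
        L→U = (λ u∈ → proj₂ L≈U (proj₁ (normal (G.ε G.∙ h)) u∈))
            , (λ p → proj₂ (normal (G.ε G.∙ h)) (proj₁ L≈U p))

  module Adjunction (ifin : IFinite system) (𝒟 : DescentBasis G 𝔐) where
    open DescentBasis 𝒟
    open MackeyMorphism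
    open ModuleMorphism

    private
      module Mack = Category (Mack 𝔐 a)
      module GAb = Category (GAbᵈ G a)

      _* : MackeyFunctor 𝔐 a → DiscreteModule G a
      F * = Functor.F₀ (colim* 𝒟 a) F

      _⁎ : DiscreteModule G a → MackeyFunctor 𝔐 a
      A ⁎ = Functor.F₀ (invariants⁎ G 𝔐 ifin a) A

    -- Germs and the unit of the adjunction.

    module Unit (F : MackeyFunctor 𝔐 a) where
      open MackeyFunctor F
      open Identifications F
      open Colimit 𝒟 F
      private
        module Φ H = AbelianGroup (Φ H)
        module C = AbelianGroup colimit
        module F* = DiscreteModule (F *)
      open SetoidReasoning C.setoid

      index : 𝔅 → Index
      index H = proj₁ (below H) , proj₁ (proj₂ (below H))

      index-≤ : ∀ H → ⟦ proj₁ (index H) ⟧ ≤ ⟦ H ⟧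
      index-≤ H = proj₂ (proj₂ (below H))

      -- The member of `𝒰` is left free here, since the proofs below move an element to whichever
      -- one suits both sides.
      germ-at : ∀ H (U : Index) → ⟦ proj₁ U ⟧ ≤ ⟦ H ⟧ → Φ.Carrier H → Germ
      germ-at H (U , U∈) U≤H x = (U , U∈) , res U H (𝒰⊆𝐫 H U U∈ U≤H) $ x

      -- Restricted further to a common `W` inside `U` and `V`, both germs become the direct
      -- restriction from `H` to `W`.
      germ-at-independent : ∀ H U V (U≤H : ⟦ proj₁ U ⟧ ≤ ⟦ H ⟧) (V≤H : ⟦ proj₁ V ⟧ ≤ ⟦ H ⟧) x →
                            germ-at H U U≤H x ∼ germ-at H V V≤H x
      germ-at-independent H U V U≤H V≤H x =
        let (W , W≤U , W≤V) = meet U V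
            W∈ = 𝒰⊆𝐫 H (proj₁ W) (proj₂ W) (λ m → U≤H (W≤U m))
        in W , W≤U , W≤V , Φ.trans (proj₁ W)
             (res-res (proj₁ W) (proj₁ U) H _ _ W∈ x)
             (Φ.sym (proj₁ W) (res-res (proj₁ W) (proj₁ V) H _ _ W∈ x))

      germ : ∀ H → Φ.Carrier H → Germ
      germ H = germ-at H (index H) (index-≤ H)

      germ-index : ∀ U x → germ (proj₁ U) x ∼ (U , x)
      germ-index U x = begin
        germ (proj₁ U) x
          ≈⟨ germ-at-independent (proj₁ U) (index (proj₁ U)) U (index-≤ (proj₁ U)) (λ m → m) x ⟩
        germ-at (proj₁ U) U (λ m → m) x
          ≈⟨ ∼-reflexive U (res-id (proj₁ U) _ x) ⟩
        (U , x) ∎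

      -- The coprojection of the colimit. Its additivity turns the sum in `Φ U` given by the Mackey
      -- formula into a sum of germs.
      ι : ∀ U → Φ (proj₁ U) ⟶ colimit
      ι U = mkHom (Φ (proj₁ U)) colimit (U ,_) (∼-reflexive U) ι-homo
        where
        ι-homo : ∀ x y → (U , Φ._∙_ (proj₁ U) x y) ∼ (U , x) ⊕ (U , y)
        -- The sum of two germs over `U` lives over `meet U U`, which need not be `U`.
        ι-homo x y = let (W , W≤U , _) = meet U U in
          W , W≤U , (λ m → m) , Φ.trans (proj₁ W) (homo (ρ U W W≤U) x y)
            (Φ.sym (proj₁ W) (ρ-⊕ (U , x) (U , y) W (λ m → m) W≤U W≤U))

      germ-res : ∀ I H I∈ x → germ I (res I H I∈ $ x) ∼ germ H x
      germ-res I H I∈ x = begin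
        germ I (res I H I∈ $ x)
          ≈⟨ ∼-reflexive (index I) (res-res (proj₁ (index I)) I H _ I∈ _ x) ⟩
        germ-at H (index I) (λ m → Sub-≤ 𝐫 H {⟦ I ⟧} I∈ (index-≤ I m)) x
          ≈⟨ germ-at-independent H (index I) (index H) (λ m → Sub-≤ 𝐫 H {⟦ I ⟧} I∈ (index-≤ I m)) (index-≤ H) x ⟩
        germ H x ∎

      -- The members of `𝒰` chosen for `H` and `K` are unrelated. Over a common smaller `W`,
      -- normality identifies `W` with its conjugate, and `con-res` applies.
      germ-con : ∀ g H K K≈gH x → germ K (con g H K K≈gH $ x) ∼ g ⊙ germ H x
      germ-con g H K K≈gH x = let (W , W≤K , W≤H) = meet (index K) (index H) in begin
        germ K (con g H K K≈gH $ x)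
          ≈⟨ germ-at-independent K (index K) W (index-≤ K) (λ m → index-≤ K (W≤K m)) _ ⟩
        germ-at K W (λ m → index-≤ K (W≤K m)) (con g H K K≈gH $ x)
          ≈⟨ ∼-reflexive W (con-res g (proj₁ W) H (proj₁ W) K (normal-𝒰 (proj₁ W) (proj₂ W) g) _ _ K≈gH x) ⟨
        g ⊙ germ-at H W (λ m → index-≤ H (W≤H m)) x
          ≈⟨ F*.·-cong {g} {g} G.refl
               (germ-at-independent H W (index H) (λ m → index-≤ H (W≤H m)) (index-≤ H) x) ⟩
        g ⊙ germ H x ∎

      germ-ind : ∀ H I I∈ {n : ℕ} (e : Enumeration n (⟦ H ⟧ ⧸ ⟦ I ⟧)) x →
                 germ H (ind H I I∈ $ x) ∼ ∑ colimit (λ k → proj₁ (Inverse.to e k) ⊙ germ I x)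
      germ-ind H I I∈ {n} e x = begin
        germ H (ind H I I∈ $ x)
          -- The member chosen for `I` also lies in `H`, and it lies in `I` as the reduction of the
          -- Mackey formula requires.
          ≈⟨ germ-at-independent H (index H) (index I) (index-≤ H) U≤H _ ⟩
        germ-at H (index I) U≤H (ind H I I∈ $ x)
          ≈⟨ ∼-reflexive (index I) (res-ind-normal H I U I∈ _ _ (normal-𝒰 U (proj₂ (index I))) e x) ⟩
        ι (index I) $ ∑ (Φ U) summand
          ≈⟨ hom-∑ {A = Φ U} {colimit} (ι (index I)) summand ⟩
        ∑ colimit (λ k → proj₁ (Inverse.to e k) ⊙ germ I x) ∎
        where
        U = proj₁ (index I)
        summand : Fin n → Φ.Carrier U
        summand k = con𝒰 (proj₁ (Inverse.to e k)) (index I) $ proj₂ (germ I x)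
        U≤H : ⟦ U ⟧ ≤ ⟦ H ⟧
        U≤H m = Sub-≤ 𝐢 H {⟦ I ⟧} I∈ (index-≤ I m)

      -- Conjugation by an element of `H` is already trivial on `Φ H`.
      germ-fixed : ∀ H x → germ H x ∈ Fixed (F *) ⟦ H ⟧
      germ-fixed H x {h} h∈H = begin
        h ⊙ germ H x                   ≈⟨ germ-con h H H H≈hH x ⟨
        germ H (con h H H H≈hH $ x)    ≈⟨ ∼-reflexive (index H) (⟦⟧-cong (res _ H _) (con-id h H H≈hH h∈H x)) ⟩
        germ H x                       ∎
        where
        H≈hH : ⟦ H ⟧ ≈ˢ h ▹ ⟦ H ⟧
        H≈hH = proj₂ (▹-self ⟦ H ⟧ h∈H) , proj₁ (▹-self ⟦ H ⟧ h∈H)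

      unit : F Mack.⇒ ((F *) ⁎)
      unit = record
        { φ = λ H → mkHom (Φ H) (invariants (F *) ⟦ H ⟧)
            (λ x → germ H x , λ {h} → germ-fixed H x {h})
            (λ p → ∼-reflexive (index H) (⟦⟧-cong (res _ H _) p))
            (λ x y → begin
              germ H (Φ._∙_ H x y)
                ≈⟨ ∼-reflexive (index H) (homo (res _ H _) x y) ⟩
              ι (index H) $ Φ._∙_ (proj₁ (index H)) (proj₂ (germ H x)) (proj₂ (germ H y))
                ≈⟨ homo (ι (index H)) _ _ ⟩
              germ H x ⊕ germ H y ∎)
        ; φ-res = germ-res
        ; φ-ind = λ H I I∈ → germ-ind H I I∈ (proj₂ (ifin H ⟦ I ⟧ I∈))
        ; φ-con = germ-con
        }

      -- Transposition of morphisms.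

      module _ (A : DiscreteModule G a) where
        private module A = DiscreteModule A

        -- The components of `g` at members of `𝒰`, followed by the inclusions of invariants into
        -- `A`, form a cocone: restriction in `A ⁎` leaves the underlying element unchanged.
        descend : F Mack.⇒ (A ⁎) → (F *) GAb.⇒ A
        descend g = record
          { hom = mkHom colimit A.abelianGroup
              value
              (λ { {U , x} {V , y} (W , W≤U , W≤V , e) →
                A.trans (value-res U W W≤U x) (A.trans (⟦⟧-cong (φ g (proj₁ W)) e) (A.sym (value-res V W W≤V y))) })
              (λ { (U , x) (V , y) → let (W , W≤U , W≤V) = meet U V in A.trans
                (homo (φ g (proj₁ W)) _ _)
                (A.+-cong (A.sym (value-res U W W≤U x)) (A.sym (value-res V W W≤V y))) })
          ; equivariant = λ { h (U , x) → φ-con g h (proj₁ U) (proj₁ U) _ x }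
          }
          where
          value : Germ → A.Carrier
          value (U , x) = proj₁ (φ g (proj₁ U) $ x)
          value-res : ∀ U W (W≤U : W ≼ U) x → value (U , x) A.≈ value (W , ρ U W W≤U $ x)
          value-res U W W≤U x = A.sym (φ-res g (proj₁ W) (proj₁ U) _ x)

        ascend : (F *) GAb.⇒ A → F Mack.⇒ (A ⁎)
        ascend f = Mack._∘ᶜ_ {F} {(F *) ⁎} {A ⁎} (Functor.F₁ (invariants⁎ G 𝔐 ifin a) {F *} {A} f) unit

        transposition : Inverse (GAb.Hom (F *) A) (Mack.Hom F (A ⁎))
        transposition = record
          { to = ascend
          ; from = descend
          ; to-cong = λ p H x → p (germ H x)
          ; from-cong = λ { p (U , x) → p (proj₁ U) x }
          ; inverse =
              -- Descending and ascending evaluates `g` at `index H`. Compatibility with restriction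
              -- brings this back to the value at `H`.
              (λ {g} p H x → A.trans (p (germ H x)) (φ-res g (proj₁ (index H)) H _ x))
            -- In the other order, the germ of `x` is taken over the member chosen below `U`;
            -- `germ-index` identifies it with the class of `x` over `U`.
            , (λ {f} p → λ { (U , x) → A.trans (p (proj₁ U) x) (⟦⟧-cong (hom f) (germ-index U x)) })
          }

    -- Naturality and the adjunction.

    unit-natural : ∀ {F F′} (k : F′ Mack.⇒ F) H x → let open Colimit 𝒟 F in
                   hom (Functor.F₁ (colim* 𝒟 a) k) $ Unit.germ F′ H x ∼ Unit.germ F H (φ k H $ x)
    -- The choice of `index` depends on `H` alone and not on the functor, so both germs lie over the
    -- same member of `𝒰`.
    unit-natural {F} {F′} k H x = Colimit.∼-reflexive 𝒟 F (Unit.index F H) (φ-res k _ H _ x)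

    adjunction : colim* 𝒟 a ⊣ invariants⁎ G 𝔐 ifin a
    adjunction = record
      { transpose = Unit.transposition
      ; natural = λ {F} {F′} {A} {A′} k h f H x →
          ⟦⟧-cong (hom h) (⟦⟧-cong (hom f) (unit-natural {F} {F′} k H x))
      }

theorem2p3p17 : {ℓ a : Level} (G : TopologicalGroup ℓ)
    (𝔐 : MackeySystem (TopologicalGroup.group G))
    (ifin : IFinite (MackeySystem.system 𝔐))
    (𝒰 : DescentBasis G 𝔐) →
    colim* 𝒰 a ⊣ invariants⁎ G 𝔐 ifin a
theorem2p3p17 G 𝔐 ifin 𝒰 = Adjunction.adjunction G 𝔐 ifin 𝒰
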